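{- Let the sequence $(b_0,b_1,\ldots)$ be defined by $b_0:=0$ and $b_k:=B_{k-1}$ for $k\ge1$, where $B_j$ are the Bernoulli numbers. Then for all $n\ge1$, $$H_n(b_k)=\frac{2\cdot(2n+1)!}{n!^3}\cdot\mathcal{H}_{2,n}^{ - }\cdot H_n(B_k),\qquad\text{where}\quad \mathcal{H}_{2,n}^{ - }:=\sum_{j=1}^n\frac{(-1)^{j-1}}{j^2}.$$
   Context: For a sequence $(a_k)_{k\ge 0}$ and $n\ge 0$, $H_n(a_k):=\det(a_{i+j})_{0\le i,j\le n}$ denotes the $(n+1)\times(n+1)$ Hankel determinant. The Bernoulli numbers are defined by $\frac{t}{e^t-1}=\sum_{n\ge0}B_n\frac{t^n}{n!}$ (so $B_1=-1/2$). -}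

module Defs where

open import Algebra.Bundles using (CommutativeRing)
import Algebra.Properties.Semiring.Exp as Exp
import Algebra.Properties.Semiring.Sum as Sum
open import Data.Fin.Base using (Fin; zero; suc; toℕ; punchIn)
open import Data.Integer.Base using (+_)
open import Data.Nat.Base as ℕ using (ℕ; zero; suc; NonZero; _!; _∸_)
import Data.Nat.Properties as ℕ
open import Data.Rational.Base using (ℚ; 0ℚ; 1ℚ; _+_; _*_; -_; _-_; _/_; toℚᵘ)
open import Data.Rational.Properties
open import Data.Rational.Unnormalised.Base as ℚᵘ using (*≡*)
import Data.Rational.Unnormalised.Properties as ℚᵘ
import Data.Integer.Properties as ℤ
open import Data.Vec.Functional using (Vector; []; _∷_)
open import Relation.Binary.PropositionalEquality
  using (_≡_; _≗_; refl; sym; trans; cong; cong₂; module ≡-Reasoning)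

module Determinant {c ℓ} (R : CommutativeRing c ℓ) where
  private module R = CommutativeRing R
  open Sum R.semiring using (sum-syntax)
  open Exp R.semiring using (_^_)

  Matrix : ℕ → Set c
  Matrix n = Fin n → Fin n → R.Carrier

  -- Laplace expansion along the first row.
  det : ∀ {n} → Matrix n → R.Carrier
  det {zero}  M = R.1#
  det {suc n} M = ∑[ j < suc n ]
    ((R.- R.1#) ^ toℕ j R.* (M zero j R.* det (λ i k → M (suc i) (punchIn j k))))

  -- H_n(a) = det (a_{i+j}) with 0 ≤ i, j ≤ n, of size n + 1.
  hankel : (ℕ → R.Carrier) → ℕ → R.Carrier
  hankel a n = det {suc n} (λ i j → a (toℕ i ℕ.+ toℕ j))

open Determinant +-*-commutativeRing public
open Sum (CommutativeRing.semiring +-*-commutativeRing) public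
  using (sum-syntax; sum⁺-syntax; sum-cong-≗)
open Exp (CommutativeRing.semiring +-*-commutativeRing) public using (_^_)

-- A formal power series over ℚ is given by its coefficients.
Series : Set
Series = ℕ → ℚ

infixl 7 _⊛_
infixl 6 _⊝_

_⊛_ : Series → Series → Series
(f ⊛ g) n = ∑[ k ≤ n ] (f (toℕ k) * g (n ∸ toℕ k))

_⊝_ : Series → Series → Series
(f ⊝ g) n = f n - g n

one : Series
one zero    = 1ℚ
one (suc _) = 0ℚ

-- t · f
shift : Series → Series
shift f zero    = 0ℚ
shift f (suc n) = f n

-- f / t, for f with zero constant coefficient
unshift : Series → Series
unshift f n = f (suc n)

-- Reciprocal of a series with constant coefficient 1 (see ⊛-recip).
-- table f n lists the first n coefficients g of the reciprocal, last first:
-- g (n - 1), …, g 0.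
next : Series → ∀ n → Vector ℚ n → ℚ
next f zero    _ = 1ℚ
next f (suc n) t = - (∑[ i < suc n ] (f (suc (toℕ i)) * t i))

table : Series → ∀ n → Vector ℚ n
table f zero    = []
table f (suc n) = next f n (table f n) ∷ table f n

recip : Series → Series
recip f n = next f n (table f n)

1/_! : ℕ → ℚ
1/ n ! = (+ 1 / n !) {{n ℕ.!≢0}}

exp : Series
exp n = 1/ n !

-- Σ aₙ tⁿ / n!
egf : (ℕ → ℚ) → Series
egf a n = a n * 1/ n !

-- Bₙ = n! [tⁿ] 1 / ((eᵗ - 1) / t)
bernoulli : ℕ → ℚ
bernoulli n = (+ (n !) / 1) * recip (unshift (exp ⊝ one)) n

b : ℕ → ℚ
b zero    = 0ℚ
b (suc k) = bernoulli k

-- Σ_{j=1}^{n} (-1)^{j-1} / j², with j = i + 1.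
altHarmonic₂ : ℕ → ℚ
altHarmonic₂ n = ∑[ i < n ] ((- 1ℚ) ^ toℕ i * (+ 1 / (suc (toℕ i) ℕ.^ 2)))

table-recip : ∀ f n (i : Fin n) → table f n i ≡ recip f (n ∸ suc (toℕ i))
table-recip f (suc n) zero    = refl
table-recip f (suc n) (suc i) = table-recip f n i

⊛-recip : ∀ f → f 0 ≡ 1ℚ → f ⊛ recip f ≗ one
⊛-recip f f₀ zero    = cong (λ x → x * 1ℚ + 0ℚ) f₀
⊛-recip f f₀ (suc n) = begin
  f 0 * recip f (suc n) + S  ≡⟨ cong (λ x → x * recip f (suc n) + S) f₀ ⟩
  1ℚ * recip f (suc n) + S   ≡⟨ cong (_+ S) (*-identityˡ (recip f (suc n))) ⟩
  recip f (suc n) + S        ≡⟨ cong (λ x → - x + S) (sum-cong-≗ {suc n}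
                                  (λ i → cong (f (suc (toℕ i)) *_) (table-recip f (suc n) i))) ⟩
  - S + S                    ≡⟨ +-inverseˡ S ⟩
  0ℚ                         ∎
  where
  open ≡-Reasoning
  S = ∑[ i < suc n ] (f (suc (toℕ i)) * recip f (n ∸ toℕ i))

m/1*1/m≡1 : ∀ m .{{_ : NonZero m}} → (+ m / 1) * (+ 1 / m) ≡ 1ℚ
m/1*1/m≡1 m@(suc k) = toℚᵘ-injective (begin
  toℚᵘ ((+ m / 1) * (+ 1 / m))              ≈⟨ toℚᵘ-homo-* (+ m / 1) (+ 1 / m) ⟩
  toℚᵘ (+ m / 1) ℚᵘ.* toℚᵘ (+ 1 / m)        ≈⟨ ℚᵘ.*-cong (toℚᵘ-fromℚᵘ (ℚᵘ.mkℚᵘ (+ m) 0))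
                                                         (toℚᵘ-fromℚᵘ (ℚᵘ.mkℚᵘ (+ 1) k)) ⟩
  ℚᵘ.mkℚᵘ (+ m) 0 ℚᵘ.* ℚᵘ.mkℚᵘ (+ 1) k      ≈⟨ ℚᵘ.*-inverseʳ (ℚᵘ.mkℚᵘ (+ m) 0) ⟩
  toℚᵘ 1ℚ                                   ∎)
  where open ℚᵘ.≃-Reasoning

egf-bernoulli : egf bernoulli ≗ recip (unshift (exp ⊝ one))
egf-bernoulli n = begin
  ((+ (n !) / 1) * r) * 1/ n !  ≡⟨ cong (_* 1/ n !) (*-comm (+ (n !) / 1) r) ⟩
  (r * (+ (n !) / 1)) * 1/ n !  ≡⟨ *-assoc r (+ (n !) / 1) (1/ n !) ⟩
  r * ((+ (n !) / 1) * 1/ n !)  ≡⟨ cong (r *_) (m/1*1/m≡1 (n !) {{n ℕ.!≢0}}) ⟩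
  r * 1ℚ                        ≡⟨ *-identityʳ r ⟩
  r                             ∎
  where
  open ≡-Reasoning
  r = recip (unshift (exp ⊝ one)) n

-- The defining identity: (eᵗ - 1) · Σ Bₙ tⁿ / n! = t.
bernoulli-egf : (exp ⊝ one) ⊛ egf bernoulli ≗ shift one
bernoulli-egf zero    = refl
bernoulli-egf (suc n) = begin
  0ℚ * egf bernoulli (suc n) + (f ⊛ egf bernoulli) n
    ≡⟨ cong (_+ (f ⊛ egf bernoulli) n) (*-zeroˡ (egf bernoulli (suc n))) ⟩
  0ℚ + (f ⊛ egf bernoulli) n
    ≡⟨ +-identityˡ ((f ⊛ egf bernoulli) n) ⟩
  (f ⊛ egf bernoulli) n
    ≡⟨ sum-cong-≗ {suc n} (λ k → cong (f (toℕ k) *_) (egf-bernoulli (n ∸ toℕ k))) ⟩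
  (f ⊛ recip f) n
    ≡⟨ ⊛-recip f refl n ⟩
  one n ∎
  where
  open ≡-Reasoning
  f = unshift (exp ⊝ one)

{-# OPTIONS --safe #-}
-- Let L be the linear functional on polynomials with L(xᵏ) = Bₖ. Its orthogonal polynomials are the
-- Touchard polynomials, (n + 1)² Pₙ₊₁ = (2 n + 1) (2 x + 1) Pₙ + n² Pₙ₋₁. Replacing the last row of
-- either Hankel matrix by the combination of all rows with the coefficients of Pₙ leaves a single
-- nonzero entry in that row, namely L(xⁿ Pₙ) for Bₖ and L((Pₙ - Pₙ(0)) / x) for bₖ, and the
-- complementary minor is H_{n-1}(Bₖ) in both cases. So the two determinants compare like these two
-- numbers, which the three-term recurrence evaluates as soon as L(Pₙ) = 0 is known for n ≥ 1. For
-- this, L(f(x + 1)) = L(f(x)) + f′(0) gives L on falling factorials (x)ₖ, and then the recurrence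
-- gives a product formula for all L(Pₙ · (x)ₖ).
module Submission where

open import Algebra.Bundles using (CommutativeRing)
import Algebra.Properties.CommutativeSemigroup as CommutativeSemigroupProperties
import Algebra.Properties.Ring as RingProperties
import Algebra.Properties.Semiring.Exp as Exp
import Algebra.Properties.Semiring.Sum as Sum
import Defs
open import Data.Fin.Base as Fin using (Fin; zero; suc; toℕ; fromℕ; inject₁; punchIn)
import Data.Fin.Properties as Fin
open import Data.Nat.Base as ℕ using (ℕ; zero; suc; z≤n; s≤s; NonZero; _!; _∸_; _≥_)
open import Data.Product.Base using (_×_; _,_; proj₁)
open import Data.Vec.Functional using (Vector; _∷_; updateAt; removeAt; tail; init; last)
open import Data.Vec.Functional.Properties using (updateAt-updates; updateAt-minimal; updateAt-id-local; map-updateAt)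
open import Function.Base using (_∘_; const)
open import Relation.Binary.Definitions using (tri<; tri≈; tri>)
open import Relation.Binary.PropositionalEquality as ≡ using (_≡_; _≢_)
open import Relation.Nullary.Negation using (contradiction)

-- Determinants

-- The recurrence alone does not determine L(Pₙ): it brings in L(x Pₙ), then L(x² Pₙ), and so on.
-- Falling factorials keep the system tractable, because x (x)ₖ = (x)ₖ₊₁ + k (x)ₖ and L((x)ₖ) =
-- (-1)ᵏ k! / (k + 1). The product formula contains 1 / (k - n)!, to be read as 0 for k < n; so it
-- is proved as division-free relations between neighbours, in which a factor k - n carries the
-- vanishing. The alternating sum arises because uₙ = L((Pₙ - Pₙ(0)) / x) obeys the recurrence
-- without its x-term, which L(Pₙ) = 0 removes. This reads (n + 1)² (uₙ₊₁ - uₙ) = - n² (uₙ - uₙ₋₁)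
-- with u₀ = 0 and u₁ = 2, so the differences are 2 (-1)ⁿ / (n + 1)². With the scaling n!² Pₙ the
-- two numbers to compare are (-1)ⁿ n!⁵ / (2 n + 1)! and 2 n!² times the alternating sum. The sign
-- cancels against that of the surviving entry for bₖ, which stands in the first column instead of
-- the last.

punchIn-inject₁ : ∀ {n} {i j : Fin n} → i Fin.≤ j → punchIn (inject₁ i) j ≡ suc j
punchIn-inject₁ {i = zero}              _         = ≡.refl
punchIn-inject₁ {i = suc i} {j = suc j} (s≤s i≤j) = ≡.cong suc (punchIn-inject₁ i≤j)

punchIn-suc : ∀ {n} {i j : Fin n} → i Fin.≤ j → punchIn (suc j) i ≡ inject₁ i
punchIn-suc {i = zero}              _         = ≡.refl
punchIn-suc {i = suc i} {j = suc j} (s≤s i≤j) = ≡.cong suc (punchIn-suc i≤j)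

-- Both sides enumerate the columns other than i and j + 1; only the order of deletion differs.
punchIn-punchIn : ∀ {n} {i j : Fin (suc n)} → i Fin.≤ j → ∀ k →
                  punchIn (inject₁ i) (punchIn j k) ≡ punchIn (suc j) (punchIn i k)
punchIn-punchIn {i = zero}                _         k       = ≡.refl
punchIn-punchIn {i = suc i} {j = suc j}   (s≤s i≤j) zero    = ≡.refl
punchIn-punchIn {i = suc i} {j = suc j}   (s≤s i≤j) (suc k) = ≡.cong suc (punchIn-punchIn i≤j k)

punchIn-fromℕ : ∀ {n} (i : Fin n) → punchIn (fromℕ n) i ≡ inject₁ i
punchIn-fromℕ zero    = ≡.refl
punchIn-fromℕ (suc i) = ≡.cong suc (punchIn-fromℕ i)

punchIn-inject₁-fromℕ : ∀ {n} (i : Fin (suc n)) → punchIn (inject₁ i) (fromℕ n) ≡ fromℕ (suc n)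
punchIn-inject₁-fromℕ         zero    = ≡.refl
punchIn-inject₁-fromℕ {suc n} (suc i) = ≡.cong suc (punchIn-inject₁-fromℕ i)

punchIn-inject₁-inject₁ : ∀ {n} (i : Fin (suc n)) (j : Fin n) →
                          punchIn (inject₁ i) (inject₁ j) ≡ inject₁ (punchIn i j)
punchIn-inject₁-inject₁ zero    j       = ≡.refl
punchIn-inject₁-inject₁ (suc i) zero    = ≡.refl
punchIn-inject₁-inject₁ (suc i) (suc j) = ≡.cong suc (punchIn-inject₁-inject₁ i j)

module DeterminantProperties {c ℓ} (R : CommutativeRing c ℓ) where
  open CommutativeRing R hiding (zero)
  open CommutativeSemigroupProperties *-commutativeSemigroup using (x∙yz≈y∙xz)
  open CommutativeSemigroupProperties +-commutativeSemigroup using () renaming (interchange to +-interchange)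
  open RingProperties ring using (-‿distribˡ-*; -1*x≈-x)
  open Exp semiring using (_^_)
  open Sum semiring
  open Defs.Determinant R
  open import Relation.Binary.Reasoning.Setoid setoid

  private
    sgn : ∀ {n} → Fin n → Carrier
    sgn j = (- 1#) ^ toℕ j

    minor : ∀ {n} → Matrix (suc n) → Fin (suc n) → Matrix n
    minor M j i k = M (suc i) (punchIn j k)

  sum-zero : ∀ {n} {t : Vector Carrier n} → (∀ i → t i ≈ 0#) → sum t ≈ 0#
  sum-zero {n} t≈0 = trans (sum-cong-≋ t≈0) (sum-replicate-zero n)

  sum-combination : ∀ {m n} (x : Vector Carrier m) (t : Fin n → Fin m → Carrier) →
    sum (λ j → sum (λ s → x s * t j s)) ≈ sum (λ s → x s * sum (λ j → t j s))
  sum-combination x t = trans (∑-comm (λ j s → x s * t j s))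
    (sum-cong-≋ λ s → sym (*-distribˡ-sum (x s) (λ j → t j s)))

  -- An ordered pair of distinct columns is given by its first column and by the position of the
  -- second one after removal of the first; so (j , k + 1) and (k + 1 , j), j ≤ k, are f j k and f (k + 1) j.
  sum-cancelling-pairs : ∀ {n} (f : Fin (suc n) → Fin n → Carrier) →
    (∀ {j k} → j Fin.≤ k → f (inject₁ j) k + f (suc k) j ≈ 0#) →
    sum (λ j → sum (f j)) ≈ 0#
  sum-cancelling-pairs {zero}  f f≈0 = +-identityʳ 0#
  sum-cancelling-pairs {suc n} f f≈0 = begin
    A + sum (λ j → f (suc j) zero + sum (λ k → f (suc j) (suc k)))
      ≈⟨ +-congˡ (∑-distrib-+ (λ j → f (suc j) zero) (λ j → sum (λ k → f (suc j) (suc k)))) ⟩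
    A + (B + C)  ≈⟨ +-assoc A B C ⟨
    -- `A` and `B` hold the pairs that contain column 0; `C` is the same sum over the remaining
    -- columns.
    (A + B) + C  ≈⟨ +-cong (trans (sym (∑-distrib-+ (f zero) (λ j → f (suc j) zero)))
                                  (sum-zero λ k → f≈0 {zero} {k} z≤n))
                           (sum-cancelling-pairs (λ j k → f (suc j) (suc k)) (λ j≤k → f≈0 (s≤s j≤k))) ⟩
    0# + 0#      ≈⟨ +-identityʳ 0# ⟩
    0#           ∎
    where
    A = sum (f zero)
    B = sum (λ j → f (suc j) zero)
    C = sum (λ j → sum (λ k → f (suc j) (suc k)))

  det-cong : ∀ {n} {M N : Matrix n} → (∀ i j → M i j ≈ N i j) → det M ≈ det N
  det-cong {zero}  M≈N = refl
  det-cong {suc n} M≈N = sum-cong-≋ {suc n} λ j →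
    *-congˡ {sgn j} (*-cong (M≈N zero j) (det-cong λ i k → M≈N (suc i) (punchIn j k)))

  det-minors-zero : ∀ {n} (M : Matrix (suc n)) → (∀ j → det (minor M j) ≈ 0#) → det M ≈ 0#
  det-minors-zero M minors≈0 = sum-zero λ j → begin
    sgn j * (M zero j * det (minor M j))  ≈⟨ *-congˡ (*-congˡ (minors≈0 j)) ⟩
    sgn j * (M zero j * 0#)               ≈⟨ *-congˡ (zeroʳ _) ⟩
    sgn j * 0#                            ≈⟨ zeroʳ _ ⟩
    0#                                    ∎

  det-zeroRow : ∀ {n} (M : Matrix n) i → (∀ j → M i j ≈ 0#) → det M ≈ 0#
  det-zeroRow M zero    Mᵢ≈0 = sum-zero λ j →
    trans (*-congˡ {sgn j} (trans (*-congʳ {det (minor M j)} (Mᵢ≈0 j)) (zeroˡ _))) (zeroʳ _)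
  det-zeroRow M (suc i) Mᵢ≈0 = det-minors-zero M λ j →
    det-zeroRow (minor M j) i (λ k → Mᵢ≈0 (punchIn j k))

  -- The determinant as an alternating function of the rows

  private
    term : ∀ {n} → Matrix (suc (suc n)) → Fin (suc (suc n)) → Fin (suc n) → Carrier
    term M j k = sgn j * (M zero j * (sgn k * (M (suc zero) (punchIn j k) * det (minor (minor M j) k))))

    det≈∑term : ∀ {n} (M : Matrix (suc (suc n))) → det M ≈ sum (λ j → sum (term M j))
    det≈∑term M = sum-cong-≋ λ j → begin
      sgn j * (M zero j * det (minor M j))
        ≈⟨ *-congˡ (*-distribˡ-sum (M zero j) (λ k → sgn k * (M (suc zero) (punchIn j k) * det (minor (minor M j) k)))) ⟩
      sgn j * sum (λ k → M zero j * (sgn k * (M (suc zero) (punchIn j k) * det (minor (minor M j) k))))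
        ≈⟨ *-distribˡ-sum (sgn j) (λ k → M zero j * (sgn k * (M (suc zero) (punchIn j k) * det (minor (minor M j) k)))) ⟩
      sum (term M j) ∎

    -- Choosing the same two columns in the opposite order gives the same entries and the same
    -- double minor, but the position of one column drops by one, which flips the sign. `N` is kept
    -- apart from `M` so that the lemma serves both for exchanged rows and, with `N` = `M`, for
    -- equal rows.
    term-cancel : ∀ {n} (M N : Matrix (suc (suc n))) →
      (∀ j → N zero j ≈ M (suc zero) j) → (∀ j → N (suc zero) j ≈ M zero j) →
      (∀ i j → N (suc (suc i)) j ≈ M (suc (suc i)) j) →
      ∀ {j k} → j Fin.≤ k → term M (inject₁ j) k + term N (suc k) j ≈ 0#
    term-cancel M N N₀≈M₁ N₁≈M₀ N≈M {j} {k} j≤k = begin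
      sgn (inject₁ j) * (a * (sgn k * (M (suc zero) (punchIn (inject₁ j) k) * d)))
        + sgn (suc k) * (N zero (suc k) * (sgn j * (N (suc zero) (punchIn (suc k) j) * d′)))
        ≈⟨ +-cong
             (*-cong (reflexive (≡.cong ((- 1#) ^_) (Fin.toℕ-inject₁ j)))
               (*-congˡ (*-congˡ (*-congʳ (reflexive (≡.cong (M (suc zero)) (punchIn-inject₁ j≤k)))))))
             (*-cong (-1*x≈-x (sgn k)) (*-cong (N₀≈M₁ (suc k)) (*-congˡ
               (*-cong (trans (reflexive (≡.cong (N (suc zero)) (punchIn-suc j≤k))) (N₁≈M₀ _)) d′≈d)))) ⟩
      sgn j * (a * (sgn k * (b * d))) + - sgn k * (b * (sgn j * (a * d)))
        ≈⟨ +-congˡ (-‿distribˡ-* _ _) ⟨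
      sgn j * (a * (sgn k * (b * d))) - sgn k * (b * (sgn j * (a * d)))
        ≈⟨ +-congˡ (-‿cong (trans (*-congˡ (x∙yz≈y∙xz b _ _)) (x∙yz≈y∙xz _ _ _))) ⟩
      sgn j * (a * (sgn k * (b * d))) - sgn j * (sgn k * (b * (a * d)))
        ≈⟨ +-congʳ (*-congˡ (trans (x∙yz≈y∙xz a _ _) (*-congˡ (x∙yz≈y∙xz a b d)))) ⟩
      sgn j * (sgn k * (b * (a * d))) - sgn j * (sgn k * (b * (a * d)))
        ≈⟨ -‿inverseʳ _ ⟩
      0# ∎
      where
      a = M zero (inject₁ j)
      b = M (suc zero) (suc k)
      d = det (minor (minor M (inject₁ j)) k)
      d′ = det (minor (minor N (suc k)) j)
      d′≈d : d′ ≈ d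
      d′≈d = det-cong λ i l → trans (N≈M i _)
        (reflexive (≡.cong (M (suc (suc i))) (≡.sym (punchIn-punchIn j≤k l))))

    swap₀₁ : ∀ {n} → Matrix (suc (suc n)) → Matrix (suc (suc n))
    swap₀₁ M = M (suc zero) ∷ M zero ∷ tail (tail M)

  det-swap₀₁ : ∀ {n} (M : Matrix (suc (suc n))) → det M + det (swap₀₁ M) ≈ 0#
  det-swap₀₁ M = begin
    det M + det N                                            ≈⟨ +-cong (det≈∑term M) (det≈∑term N) ⟩
    sum (λ j → sum (term M j)) + sum (λ j → sum (term N j))  ≈⟨ ∑-distrib-+ (λ j → sum (term M j)) (λ j → sum (term N j)) ⟨
    sum (λ j → sum (term M j) + sum (term N j))              ≈⟨ sum-cong-≋ (λ j → sym (∑-distrib-+ (term M j) (term N j))) ⟩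
    sum (λ j → sum (λ k → term M j k + term N j k))
      ≈⟨ sum-cancelling-pairs (λ j k → term M j k + term N j k) (λ {j} {k} j≤k → begin
           (term M (inject₁ j) k + term N (inject₁ j) k) + (term M (suc k) j + term N (suc k) j)
             ≈⟨ +-congˡ (+-comm _ _) ⟩
           (term M (inject₁ j) k + term N (inject₁ j) k) + (term N (suc k) j + term M (suc k) j)
             ≈⟨ +-interchange _ _ _ _ ⟩
           (term M (inject₁ j) k + term N (suc k) j) + (term N (inject₁ j) k + term M (suc k) j)
             ≈⟨ +-cong (term-cancel M N (λ _ → refl) (λ _ → refl) (λ _ _ → refl) j≤k)
                       (term-cancel N M (λ _ → refl) (λ _ → refl) (λ _ _ → refl) j≤k) ⟩
           0# + 0#  ≈⟨ +-identityʳ 0# ⟩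
           0# ∎) ⟩
    0# ∎
    where N = swap₀₁ M

  -- Equality of rows 0 and 1 is settled by pair cancellation, since `det M + det M ≈ 0#` would not
  -- give `det M ≈ 0#` in a general commutative ring. If row 0 equals a later row, exchanging rows 0
  -- and 1 moves both equal rows below the first, where they survive in every minor.
  det-equalRows-< : ∀ {n} (M : Matrix n) {i k} → i Fin.< k → (∀ j → M i j ≈ M k j) → det M ≈ 0#
  det-equalRows-< M {zero} {suc zero} _ eq = trans (det≈∑term M)
    (sum-cancelling-pairs (term M) (term-cancel M M eq (sym ∘ eq) (λ _ _ → refl)))
  det-equalRows-< {suc (suc (suc n))} M {zero} {suc (suc k)} _ eq = begin
    det M                    ≈⟨ +-identityʳ _ ⟨
    det M + 0#               ≈⟨ +-congˡ (det-minors-zero (swap₀₁ M) λ j →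
                                  det-equalRows-< (minor (swap₀₁ M) j) {zero} {suc k} (s≤s z≤n) (eq ∘ punchIn j)) ⟨
    det M + det (swap₀₁ M)   ≈⟨ det-swap₀₁ M ⟩
    0#                       ∎
  det-equalRows-< M {suc i} {suc k} (s≤s i<k) eq = det-minors-zero M λ j →
    det-equalRows-< (minor M j) i<k (eq ∘ punchIn j)

  det-equalRows : ∀ {n} (M : Matrix n) {i k} → i ≢ k → (∀ j → M i j ≈ M k j) → det M ≈ 0#
  det-equalRows M {i} {k} i≢k eq with Fin.<-cmp i k
  ... | tri< i<k _ _ = det-equalRows-< M i<k eq
  ... | tri≈ _ i≡k _ = contradiction i≡k i≢k
  ... | tri> _ _ k<i = det-equalRows-< M k<i (sym ∘ eq)

  -- Linearity in a row

  private
    minor-updateAt : ∀ {n} (M : Matrix (suc n)) i v j r k →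
      minor (updateAt M (suc i) (const v)) j r k ≡ updateAt (minor M j) i (const (v ∘ punchIn j)) r k
    minor-updateAt M i v j r k =
      ≡.cong-app (map-updateAt {f = _∘ punchIn j} {g = const v} (λ _ → ≡.refl) (tail M) i r) k

  det-linear : ∀ {m n} (M : Matrix n) i (x : Vector Carrier m) (V : Fin m → Fin n → Carrier) →
    det (updateAt M i (const (λ k → sum (λ s → x s * V s k)))) ≈
    sum (λ s → x s * det (updateAt M i (const (V s))))
  det-linear {m} M zero x V = trans (sum-cong-≋ λ j → begin
    sgn j * (sum (λ s → x s * V s j) * det (minor M j))
      ≈⟨ *-congˡ (*-distribʳ-sum (det (minor M j)) (λ s → x s * V s j)) ⟩
    sgn j * sum (λ s → x s * V s j * det (minor M j))
      ≈⟨ *-distribˡ-sum (sgn j) (λ s → x s * V s j * det (minor M j)) ⟩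
    sum (λ s → sgn j * (x s * V s j * det (minor M j)))
      ≈⟨ sum-cong-≋ {m} (λ s → trans (*-congˡ (*-assoc _ _ _)) (x∙yz≈y∙xz _ _ _)) ⟩
    sum (λ s → x s * (sgn j * (V s j * det (minor M j)))) ∎)
    (sum-combination x (λ j s → sgn j * (V s j * det (minor M j))))
  det-linear {m} {suc n} M (suc i) x V = trans (sum-cong-≋ λ j → begin
    sgn j * (M zero j * det (minor (updateAt M (suc i) (const (λ k → sum (λ s → x s * V s k)))) j))
      ≈⟨ *-congˡ (*-congˡ (det-cong λ r k → reflexive (minor-updateAt M i _ j r k))) ⟩
    sgn j * (M zero j * det (updateAt (minor M j) i (const (λ k → sum (λ s → x s * V s (punchIn j k))))))
      ≈⟨ *-congˡ (*-congˡ (det-linear (minor M j) i x (λ s → V s ∘ punchIn j))) ⟩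
    sgn j * (M zero j * sum (λ s → x s * D j s))
      ≈⟨ *-congˡ (*-distribˡ-sum (M zero j) (λ s → x s * D j s)) ⟩
    sgn j * sum (λ s → M zero j * (x s * D j s))
      ≈⟨ *-distribˡ-sum (sgn j) (λ s → M zero j * (x s * D j s)) ⟩
    sum (λ s → sgn j * (M zero j * (x s * D j s)))
      ≈⟨ sum-cong-≋ {m} (λ s → trans (*-congˡ (x∙yz≈y∙xz _ _ _)) (x∙yz≈y∙xz _ _ _)) ⟩
    sum (λ s → x s * (sgn j * (M zero j * D j s)))
      ≈⟨ sum-cong-≋ (λ s → *-congˡ (*-congˡ (*-congˡ (det-cong λ r k → reflexive (minor-updateAt M i (V s) j r k))))) ⟨
    sum (λ s → x s * (sgn j * (M zero j * det (minor (updateAt M (suc i) (const (V s))) j)))) ∎)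
    (sum-combination x (λ j s → sgn j * (M zero j * det (minor (updateAt M (suc i) (const (V s))) j))))
    where
    D : Fin (suc n) → _ → Carrier
    D j s = det (updateAt (minor M j) i (const (V s ∘ punchIn j)))

  -- By linearity in row i, each summand with s ≠ i contains row s twice and vanishes.
  det-combineRows : ∀ {n} (M : Matrix n) i (x : Vector Carrier n) →
    det (updateAt M i (const (λ k → sum (λ s → x s * M s k)))) ≈ x i * det M
  det-combineRows {suc n} M i x = begin
    det (updateAt M i (const (λ k → sum (λ s → x s * M s k))))  ≈⟨ det-linear M i x M ⟩
    sum t                                                       ≈⟨ sum-remove {i = i} t ⟩
    t i + sum (removeAt t i)
      ≈⟨ +-cong (*-congˡ (det-cong λ r k → reflexive (≡.cong-app (updateAt-id-local i M ≡.refl r) k)))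
                (sum-zero λ s → trans (*-congˡ (repeated (Fin.punchInᵢ≢i i s))) (zeroʳ _)) ⟩
    x i * det M + 0#                                            ≈⟨ +-identityʳ _ ⟩
    x i * det M                                                 ∎
    where
    t : Vector Carrier (suc n)
    t s = x s * det (updateAt M i (const (M s)))
    repeated : ∀ {s} → s ≢ i → det (updateAt M i (const (M s))) ≈ 0#
    repeated {s} s≢i = det-equalRows (updateAt M i (const (M s))) s≢i λ k → reflexive (≡.cong-app
      (≡.trans (updateAt-minimal s i M s≢i) (≡.sym (updateAt-updates i M))) k)

  -- As `det` expands along the first row, the last row is reached by induction: the minor without
  -- the last column has a zero last row, and every other minor is again of the assumed shape with
  -- the same corner entry.
  det-lastRow-last : ∀ {n} (M : Matrix (suc n)) → (∀ j → M (fromℕ n) (inject₁ j) ≈ 0#) →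
    det M ≈ M (fromℕ n) (fromℕ n) * det (λ i j → M (inject₁ i) (inject₁ j))
  det-lastRow-last {zero}  M _      = trans (+-identityʳ _) (*-identityˡ _)
  det-lastRow-last {suc n} M last≈0 = begin
    sum t                     ≈⟨ sum-init-last t ⟩
    sum (init t) + last t     ≈⟨ +-congˡ (trans (*-congˡ (trans (*-congˡ
                                   (det-zeroRow (minor M (fromℕ (suc n))) (fromℕ n) λ j →
                                     trans (reflexive (≡.cong (M (fromℕ (suc n))) (punchIn-fromℕ j))) (last≈0 j)))
                                   (zeroʳ _))) (zeroʳ _)) ⟩
    sum (init t) + 0#         ≈⟨ +-identityʳ _ ⟩
    sum (init t)              ≈⟨ sum-cong-≋ step ⟩
    sum (λ j → h * (sgn j * (A zero j * det (minor A j))))  ≈⟨ *-distribˡ-sum h (λ j → sgn j * (A zero j * det (minor A j))) ⟨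
    h * det A                 ∎
    where
    t : Vector Carrier (suc (suc n))
    t j = sgn j * (M zero j * det (minor M j))
    h = M (fromℕ (suc n)) (fromℕ (suc n))
    A : Matrix (suc n)
    A i j = M (inject₁ i) (inject₁ j)
    step : ∀ j → t (inject₁ j) ≈ h * (sgn j * (A zero j * det (minor A j)))
    step j = begin
      sgn (inject₁ j) * (A zero j * det N)
        ≈⟨ *-cong (reflexive (≡.cong ((- 1#) ^_) (Fin.toℕ-inject₁ j)))
             (*-congˡ (det-lastRow-last N λ k →
               trans (reflexive (≡.cong (M (fromℕ (suc n))) (punchIn-inject₁-inject₁ j k))) (last≈0 _))) ⟩
      sgn j * (A zero j * (N (fromℕ n) (fromℕ n) * det (λ i k → N (inject₁ i) (inject₁ k))))
        ≈⟨ *-congˡ (*-congˡ (*-cong (reflexive (≡.cong (M (fromℕ (suc n))) (punchIn-inject₁-fromℕ j)))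
             (det-cong λ i k → reflexive (≡.cong (M (suc (inject₁ i))) (punchIn-inject₁-inject₁ j k))))) ⟩
      sgn j * (A zero j * (h * det (minor A j)))
        ≈⟨ trans (*-congˡ (x∙yz≈y∙xz _ _ _)) (x∙yz≈y∙xz _ _ _) ⟩
      h * (sgn j * (A zero j * det (minor A j))) ∎
      where N = minor M (inject₁ j)

  -- Now the minor without column 0 is the one that vanishes. The remaining columns are numbered one
  -- lower in `A` than in `M`, so each level of the induction contributes a factor -1.
  det-lastRow-first : ∀ {n} (M : Matrix (suc n)) → (∀ j → M (fromℕ n) (suc j) ≈ 0#) →
    det M ≈ (- 1#) ^ n * (M (fromℕ n) zero * det (λ i j → M (inject₁ i) (suc j)))
  det-lastRow-first {zero}  M _      = +-identityʳ _
  det-lastRow-first {suc n} M last≈0 = begin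
    t zero + sum (tail t)     ≈⟨ +-congʳ (trans (*-congˡ (trans (*-congˡ
                                   (det-zeroRow (minor M zero) (fromℕ n) last≈0)) (zeroʳ _))) (zeroʳ _)) ⟩
    0# + sum (tail t)         ≈⟨ +-identityˡ _ ⟩
    sum (tail t)              ≈⟨ sum-cong-≋ step ⟩
    sum (λ j → h * (sgn j * (A zero j * det (minor A j))))  ≈⟨ *-distribˡ-sum h (λ j → sgn j * (A zero j * det (minor A j))) ⟨
    h * det A                 ≈⟨ *-assoc _ _ _ ⟩
    (- 1#) ^ suc n * (M (fromℕ (suc n)) zero * det A)  ∎
    where
    t : Vector Carrier (suc (suc n))
    t j = sgn j * (M zero j * det (minor M j))
    h = (- 1#) ^ suc n * M (fromℕ (suc n)) zero
    A : Matrix (suc n)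
    A i j = M (inject₁ i) (suc j)
    step : ∀ j → t (suc j) ≈ h * (sgn j * (A zero j * det (minor A j)))
    step j = begin
      - 1# * sgn j * (A zero j * det (minor M (suc j)))
        ≈⟨ *-congˡ (*-congˡ (det-lastRow-first (minor M (suc j)) (last≈0 ∘ punchIn j))) ⟩
      - 1# * sgn j * (A zero j * ((- 1#) ^ n * (w * d)))
        ≈⟨ *-congˡ (*-congˡ (*-assoc _ _ _)) ⟨
      - 1# * sgn j * (A zero j * ((- 1#) ^ n * w * d))
        ≈⟨ trans (*-congˡ (x∙yz≈y∙xz _ _ _)) (trans (*-assoc _ _ _) (*-congˡ (x∙yz≈y∙xz _ _ _))) ⟩
      - 1# * ((- 1#) ^ n * w * (sgn j * (A zero j * d)))
        ≈⟨ trans (sym (*-assoc _ _ _)) (*-congʳ (sym (*-assoc _ _ _))) ⟩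
      h * (sgn j * (A zero j * d)) ∎
      where
      w = M (fromℕ (suc n)) zero
      d = det (minor A j)

  -- Hankel determinants with the last row replaced by a combination of rows

  private
    combined : (a x : ℕ → Carrier) → ∀ n → Matrix (suc n)
    combined a x n = updateAt (λ i j → a (toℕ i ℕ.+ toℕ j)) (fromℕ n)
      (const (λ k → sum {suc n} (λ s → x (toℕ s) * a (toℕ s ℕ.+ toℕ k))))

    combined-last : ∀ a x n k →
      combined a x n (fromℕ n) k ≡ sum {suc n} (λ s → x (toℕ s) * a (toℕ s ℕ.+ toℕ k))
    combined-last a x n k = ≡.cong-app (updateAt-updates (fromℕ n) _) k

    combined-inject₁ : ∀ a x n i k → combined a x n (inject₁ i) k ≡ a (toℕ i ℕ.+ toℕ k)
    combined-inject₁ a x n i k = ≡.trans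
      (≡.cong-app (updateAt-minimal (inject₁ i) (fromℕ n) _ (Fin.fromℕ≢inject₁ ∘ ≡.sym)) k)
      (≡.cong (λ m → a (m ℕ.+ toℕ k)) (Fin.toℕ-inject₁ i))

    det-combined : ∀ a x n → x n * hankel a n ≈ det (combined a x n)
    det-combined a x n = begin
      x n * hankel a n                 ≈⟨ *-congʳ (reflexive (≡.cong x (Fin.toℕ-fromℕ n))) ⟨
      x (toℕ (fromℕ n)) * hankel a n   ≈⟨ det-combineRows _ (fromℕ n) (x ∘ toℕ) ⟨
      det (combined a x n)             ∎

  -- If `a` is the moment sequence of a functional, the hypothesis says that the polynomial with
  -- coefficients `x` is orthogonal to all powers below the n-th.
  hankel-lastRow-last : ∀ a x n →
    (∀ k → k ℕ.< n → sum {suc n} (λ s → x (toℕ s) * a (toℕ s ℕ.+ k)) ≈ 0#) →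
    x n * hankel a n ≈
    sum {suc n} (λ s → x (toℕ s) * a (toℕ s ℕ.+ n)) * det {n} (λ i j → a (toℕ i ℕ.+ toℕ j))
  hankel-lastRow-last a x n x⊥a = begin
    x n * hankel a n      ≈⟨ det-combined a x n ⟩
    det (combined a x n)  ≈⟨ det-lastRow-last (combined a x n) (λ j →
                               trans (reflexive (combined-last a x n (inject₁ j))) (x⊥a _ (Fin.inject₁ℕ< j))) ⟩
    combined a x n (fromℕ n) (fromℕ n) * det (λ i j → combined a x n (inject₁ i) (inject₁ j))
      ≈⟨ *-cong
           (reflexive (≡.trans (combined-last a x n (fromℕ n))
             (≡.cong (λ m → sum {suc n} (λ s → x (toℕ s) * a (toℕ s ℕ.+ m))) (Fin.toℕ-fromℕ n))))
           (det-cong λ i j → reflexive (≡.trans (combined-inject₁ a x n i (inject₁ j))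
             (≡.cong (λ m → a (toℕ i ℕ.+ m)) (Fin.toℕ-inject₁ j)))) ⟩
    sum {suc n} (λ s → x (toℕ s) * a (toℕ s ℕ.+ n)) * det {n} (λ i j → a (toℕ i ℕ.+ toℕ j)) ∎

  -- The orthogonality concerns the moments shifted by one, so column 0 is the one that survives.
  hankel-lastRow-first : ∀ a x n →
    (∀ k → k ℕ.< n → sum {suc n} (λ s → x (toℕ s) * a (toℕ s ℕ.+ suc k)) ≈ 0#) →
    x n * hankel a n ≈
    (- 1#) ^ n * (sum {suc n} (λ s → x (toℕ s) * a (toℕ s ℕ.+ 0)) * det {n} (λ i j → a (toℕ i ℕ.+ suc (toℕ j))))
  hankel-lastRow-first a x n x⊥a = begin
    x n * hankel a n      ≈⟨ det-combined a x n ⟩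
    det (combined a x n)  ≈⟨ det-lastRow-first (combined a x n) (λ j →
                               trans (reflexive (combined-last a x n (suc j))) (x⊥a _ (Fin.toℕ<n j))) ⟩
    (- 1#) ^ n * (combined a x n (fromℕ n) zero * det (λ i j → combined a x n (inject₁ i) (suc j)))
      ≈⟨ *-congˡ (*-cong (reflexive (combined-last a x n zero))
           (det-cong λ i j → reflexive (combined-inject₁ a x n i (suc j)))) ⟩
    (- 1#) ^ n * (sum {suc n} (λ s → x (toℕ s) * a (toℕ s ℕ.+ 0)) * det {n} (λ i j → a (toℕ i ℕ.+ suc (toℕ j)))) ∎

open import Data.Integer.Base as ℤ using (+_)
import Data.Integer.Properties as ℤ
import Data.Integer.Solver as ℤ
import Data.Nat.Properties as ℕ
open import Data.Nat.Properties using (m^n≢0; _!≢0)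
open import Data.Rational.Base using (ℚ; 0ℚ; 1ℚ; _+_; _*_; -_; _-_; _/_; toℚᵘ)
open import Data.Rational.Properties
open import Data.Rational.Solver using (module +-*-Solver)
open import Data.Rational.Unnormalised.Base as ℚᵘ using (*≡*)
import Data.Rational.Unnormalised.Properties as ℚᵘ
open import Defs
open import Relation.Binary.PropositionalEquality

open +-*-Solver using (solve; _:=_; _:+_; _:*_; _:-_; :-_; con)
open Sum (CommutativeRing.semiring +-*-commutativeRing) using (sum; *-distribˡ-sum; ∑-distrib-+; sum-init-last)
open DeterminantProperties +-*-commutativeRing using (sum-zero; det-cong; hankel-lastRow-last; hankel-lastRow-first)

-- Natural numbers in ℚ

ι : ℕ → ℚ
ι n = + n / 1

toℚᵘ-/ : ∀ m d → toℚᵘ (+ m / suc d) ℚᵘ.≃ ℚᵘ.mkℚᵘ (+ m) d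
toℚᵘ-/ m d = toℚᵘ-fromℚᵘ (ℚᵘ.mkℚᵘ (+ m) d)

ι-+ : ∀ m n → ι (m ℕ.+ n) ≡ ι m + ι n
ι-+ m n = toℚᵘ-injective (begin
  toℚᵘ (ι (m ℕ.+ n))                      ≈⟨ toℚᵘ-/ (m ℕ.+ n) 0 ⟩
  ℚᵘ.mkℚᵘ (+ (m ℕ.+ n)) 0                 ≈⟨ *≡* (trans (cong (ℤ._* + 1) (ℤ.pos-+ m n))
                                               (ℤS.solve 2 (λ x y → (x ℤS.:+ y) ℤS.:* ℤS.con (+ 1) ℤS.:=
                                                 (x ℤS.:* ℤS.con (+ 1) ℤS.:+ y ℤS.:* ℤS.con (+ 1)) ℤS.:* ℤS.con (+ 1)) refl (+ m) (+ n))) ⟩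
  ℚᵘ.mkℚᵘ (+ m) 0 ℚᵘ.+ ℚᵘ.mkℚᵘ (+ n) 0    ≈⟨ ℚᵘ.+-cong (toℚᵘ-/ m 0) (toℚᵘ-/ n 0) ⟨
  toℚᵘ (ι m) ℚᵘ.+ toℚᵘ (ι n)              ≈⟨ toℚᵘ-homo-+ (ι m) (ι n) ⟨
  toℚᵘ (ι m + ι n)                        ∎)
  where
  open ℚᵘ.≃-Reasoning
  module ℤS = ℤ.+-*-Solver

ι-suc : ∀ n → ι (suc n) ≡ ι n + 1ℚ
ι-suc n = trans (ι-+ 1 n) (+-comm 1ℚ (ι n))

ι-*-/ : ∀ m d .{{_ : NonZero d}} → ι d * (+ m / d) ≡ ι m
ι-*-/ m d@(suc k) = toℚᵘ-injective (begin
  toℚᵘ (ι d * (+ m / d))                  ≈⟨ toℚᵘ-homo-* (ι d) (+ m / d) ⟩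
  toℚᵘ (ι d) ℚᵘ.* toℚᵘ (+ m / d)          ≈⟨ ℚᵘ.*-cong (toℚᵘ-/ d 0) (toℚᵘ-/ m k) ⟩
  ℚᵘ.mkℚᵘ (+ d) 0 ℚᵘ.* ℚᵘ.mkℚᵘ (+ m) k    ≈⟨ *≡* (trans (ℤ.*-identityʳ (+ d ℤ.* + m)) (trans (ℤ.*-comm (+ d) (+ m))
                                               (cong (λ e → + m ℤ.* + suc e) (sym (ℕ.+-identityʳ k))))) ⟩
  ℚᵘ.mkℚᵘ (+ m) 0                         ≈⟨ toℚᵘ-/ m 0 ⟨
  toℚᵘ (ι m)                              ∎)
  where open ℚᵘ.≃-Reasoning

ι-* : ∀ m n → ι (m ℕ.* n) ≡ ι m * ι n
ι-* zero    n = sym (*-zeroˡ (ι n))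
ι-* (suc m) n = begin
  ι (n ℕ.+ m ℕ.* n)    ≡⟨ ι-+ n (m ℕ.* n) ⟩
  ι n + ι (m ℕ.* n)    ≡⟨ cong (λ x → ι n + x) (ι-* m n) ⟩
  ι n + ι m * ι n      ≡⟨ solve 2 (λ m n → n :+ m :* n := (m :+ con 1ℚ) :* n) refl (ι m) (ι n) ⟩
  (ι m + 1ℚ) * ι n     ≡⟨ cong (_* ι n) (ι-suc m) ⟨
  ι (suc m) * ι n      ∎
  where open ≡-Reasoning

ι-cancel : ∀ d .{{_ : NonZero d}} {x y} → ι d * x ≡ ι d * y → x ≡ y
ι-cancel d {x} {y} eq = begin
  x                        ≡⟨ expand x ⟩
  (+ 1 / d) * (ι d * x)    ≡⟨ cong ((+ 1 / d) *_) eq ⟩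
  (+ 1 / d) * (ι d * y)    ≡⟨ expand y ⟨
  y                        ∎
  where
  open ≡-Reasoning
  expand : ∀ z → z ≡ (+ 1 / d) * (ι d * z)
  expand z = begin
    z                        ≡⟨ *-identityˡ z ⟨
    1ℚ * z                   ≡⟨ cong (_* z) (m/1*1/m≡1 d) ⟨
    ι d * (+ 1 / d) * z      ≡⟨ cong (_* z) (*-comm (ι d) (+ 1 / d)) ⟩
    (+ 1 / d) * ι d * z      ≡⟨ *-assoc (+ 1 / d) (ι d) z ⟩
    (+ 1 / d) * (ι d * z)    ∎

-- The factors 2 n + 1 of the three-term recurrence and k + n + 1 of the product formula are
-- cancelled in this shape.
ι+ι+1-cancel : ∀ m n {x y} → (ι m + ι n + 1ℚ) * x ≡ (ι m + ι n + 1ℚ) * y → x ≡ y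
ι+ι+1-cancel m n eq = ι-cancel (suc (m ℕ.+ n)) (subst (λ e → e * _ ≡ e * _)
  (sym (trans (ι-suc (m ℕ.+ n)) (cong (_+ 1ℚ) (ι-+ m n)))) eq)

-- Bernoulli moments of falling factorials

D : Series → Series
D f n = ι (suc n) * f (suc n)

⊛-cong : ∀ {f f′ g g′ : Series} → f ≗ f′ → g ≗ g′ → f ⊛ g ≗ f′ ⊛ g′
⊛-cong f≗f′ g≗g′ n = sum-cong-≗ {suc n} λ k → cong₂ _*_ (f≗f′ (toℕ k)) (g≗g′ (n ∸ toℕ k))

-- Leibniz rule for d/dt: the factor n + 1 splits as k + (n + 1 - k), and each half loses the
-- boundary term in which its factor is 0.
D-⊛ : ∀ f g n → D (f ⊛ g) n ≡ (D f ⊛ g) n + (f ⊛ D g) n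
D-⊛ f g n = begin
  ι (suc n) * sum t                    ≡⟨ *-distribˡ-sum (ι (suc n)) t ⟩
  sum (λ k → ι (suc n) * t k)          ≡⟨ sum-cong-≗ {suc (suc n)} split ⟩
  sum (λ k → u k + v k)                ≡⟨ ∑-distrib-+ u v ⟩
  sum u + sum v                        ≡⟨ cong₂ _+_ sum-u sum-v ⟩
  (D f ⊛ g) n + (f ⊛ D g) n            ∎
  where
  open ≡-Reasoning
  t u v : Fin (suc (suc n)) → ℚ
  t k = f (toℕ k) * g (suc n ∸ toℕ k)
  u k = ι (toℕ k) * f (toℕ k) * g (suc n ∸ toℕ k)
  v k = f (toℕ k) * (ι (suc n ∸ toℕ k) * g (suc n ∸ toℕ k))
  split : ∀ k → ι (suc n) * t k ≡ u k + v k
  split k = trans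
    (cong (λ m → ι m * t k) (sym (ℕ.m+[n∸m]≡n (Fin.toℕ≤pred[n] k))))
    (trans (cong (_* t k) (ι-+ (toℕ k) (suc n ∸ toℕ k)))
      (solve 4 (λ x y a b → (x :+ y) :* (a :* b) := x :* a :* b :+ a :* (y :* b)) refl
        (ι (toℕ k)) (ι (suc n ∸ toℕ k)) (f (toℕ k)) (g (suc n ∸ toℕ k))))
  sum-u : sum u ≡ (D f ⊛ g) n
  sum-u = trans (cong (_+ sum {suc n} (λ k → u (suc k)))
    (solve 2 (λ a b → con 0ℚ :* a :* b := con 0ℚ) refl (f 0) (g (suc n))))
    (+-identityˡ ((D f ⊛ g) n))
  sum-v : sum v ≡ (f ⊛ D g) n
  sum-v = begin
    sum v                                             ≡⟨ sum-init-last v ⟩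
    sum {suc n} (λ k → v (inject₁ k)) + v (fromℕ (suc n))
      ≡⟨ cong₂ _+_ (sum-cong-≗ {suc n} λ k → begin
           v (inject₁ k)
             ≡⟨ cong (λ m → f m * (ι (suc n ∸ m) * g (suc n ∸ m))) (Fin.toℕ-inject₁ k) ⟩
           f (toℕ k) * (ι (suc n ∸ toℕ k) * g (suc n ∸ toℕ k))
             ≡⟨ cong (λ m → f (toℕ k) * (ι m * g m)) (ℕ.+-∸-assoc 1 (Fin.toℕ≤pred[n] k)) ⟩
           f (toℕ k) * D g (n ∸ toℕ k) ∎)
         (trans (cong (λ m → f m * (ι (suc n ∸ m) * g (suc n ∸ m))) (Fin.toℕ-fromℕ (suc n)))
           (trans (cong (λ m → f (suc n) * (ι m * g m)) (ℕ.n∸n≡0 n))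
             (solve 2 (λ a b → a :* (con 0ℚ :* b) := con 0ℚ) refl (f (suc n)) (g 0)))) ⟩
    (f ⊛ D g) n + 0ℚ                                  ≡⟨ +-identityʳ _ ⟩
    (f ⊛ D g) n                                       ∎

one-⊛ : ∀ f → one ⊛ f ≗ f
one-⊛ f n = trans (cong₂ _+_ (*-identityˡ (f n))
  (sum-zero {n} (λ k → *-zeroˡ (f (n ∸ suc (toℕ k)))))) (+-identityʳ (f n))

⊛-⊝ : ∀ f g h n → ((f ⊝ g) ⊛ h) n + (g ⊛ h) n ≡ (f ⊛ h) n
⊛-⊝ f g h n = trans
  (sym (∑-distrib-+ {suc n} (λ k → (f ⊝ g) (toℕ k) * h (n ∸ toℕ k)) (λ k → g (toℕ k) * h (n ∸ toℕ k))))
  (sum-cong-≗ {suc n} λ k → solve 3 (λ f g h → (f :- g) :* h :+ g :* h := f :* h) refl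
    (f (toℕ k)) (g (toℕ k)) (h (n ∸ toℕ k)))

n!*1/n!≡1 : ∀ n → ι (n !) * 1/ n ! ≡ 1ℚ
n!*1/n!≡1 n = m/1*1/m≡1 (n !) {{n ℕ.!≢0}}

D-exp : D exp ≗ exp
D-exp n = ι-cancel (n !) {{n ℕ.!≢0}} (begin
  ι (n !) * (ι (suc n) * 1/ suc n !)    ≡⟨ solve 3 (λ a b c → a :* (b :* c) := b :* a :* c) refl (ι (n !)) (ι (suc n)) (1/ suc n !) ⟩
  ι (suc n) * ι (n !) * 1/ suc n !      ≡⟨ cong (_* 1/ suc n !) (ι-* (suc n) (n !)) ⟨
  ι (suc n !) * 1/ suc n !              ≡⟨ n!*1/n!≡1 (suc n) ⟩
  1ℚ                                    ≡⟨ n!*1/n!≡1 n ⟨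
  ι (n !) * 1/ n !                      ∎)
  where open ≡-Reasoning

D-egf : ∀ a → D (egf a) ≗ egf (unshift a)
D-egf a n = trans
  (solve 3 (λ x y z → x :* (y :* z) := y :* (x :* z)) refl (ι (suc n)) (a (suc n)) (1/ suc n !))
  (cong (a (suc n) *_) (D-exp n))

egf-injective : ∀ a c n → egf a n ≡ egf c n → a n ≡ c n
egf-injective a c n eq = trans (sym (recover a)) (trans (cong (ι (n !) *_) eq) (recover c))
  where
  recover : ∀ c → ι (n !) * egf c n ≡ c n
  recover c = trans (solve 3 (λ x y z → x :* (y :* z) := y :* (x :* z)) refl (ι (n !)) (c n) (1/ n !))
    (trans (cong (c n *_) (n!*1/n!≡1 n)) (*-identityʳ (c n)))

-- With aₖ the moments L(xᵏ) of a functional L, these are the moments L((x + 1)ᵏ).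
binomialTransform : Series → Series
binomialTransform a zero    = a 0
binomialTransform a (suc n) = binomialTransform a n + binomialTransform (unshift a) n

-- Both sides have the same constant coefficient, and the recursion of `binomialTransform` mirrors
-- (eᵗ A)′ = eᵗ A + eᵗ A′.
egf-binomialTransform : ∀ n a → egf (binomialTransform a) n ≡ (exp ⊛ egf a) n
egf-binomialTransform zero    a = solve 1 (λ x → x :* con 1ℚ := con 1ℚ :* (x :* con 1ℚ) :+ con 0ℚ) refl (a 0)
egf-binomialTransform (suc n) a = ι-cancel (suc n) (begin
  D (egf (binomialTransform a)) n                          ≡⟨ D-egf (binomialTransform a) n ⟩
  binomialTransform a (suc n) * 1/ n !                     ≡⟨ *-distribʳ-+ (1/ n !) (binomialTransform a n) (binomialTransform (unshift a) n) ⟩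
  egf (binomialTransform a) n + egf (binomialTransform (unshift a)) n
    ≡⟨ cong₂ _+_ (egf-binomialTransform n a) (egf-binomialTransform n (unshift a)) ⟩
  (exp ⊛ egf a) n + (exp ⊛ egf (unshift a)) n
    ≡⟨ cong₂ _+_ (⊛-cong {g = egf a} D-exp (λ _ → refl) n) (⊛-cong {f = exp} (λ _ → refl) (D-egf a) n) ⟨
  (D exp ⊛ egf a) n + (exp ⊛ D (egf a)) n                  ≡⟨ D-⊛ exp (egf a) n ⟨
  D (exp ⊛ egf a) n                                        ∎)
  where open ≡-Reasoning

egf-shift-one : egf (shift one) ≗ shift one
egf-shift-one zero          = refl
egf-shift-one (suc zero)    = refl
egf-shift-one (suc (suc n)) = *-zeroˡ (1/ suc (suc n) !)

-- Read off from eᵗ G = G + t. As `shift one` is the moment sequence of f ↦ f′(0), this is L(f(x +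
-- 1)) = L(f) + f′(0) for f = xⁿ.
binomialTransform-bernoulli : ∀ n → binomialTransform bernoulli n ≡ bernoulli n + shift one n
binomialTransform-bernoulli n = egf-injective (binomialTransform bernoulli) (λ m → bernoulli m + shift one m) n (begin
  egf (binomialTransform bernoulli) n                              ≡⟨ egf-binomialTransform n bernoulli ⟩
  (exp ⊛ egf bernoulli) n                                          ≡⟨ ⊛-⊝ exp one (egf bernoulli) n ⟨
  ((exp ⊝ one) ⊛ egf bernoulli) n + (one ⊛ egf bernoulli) n        ≡⟨ cong₂ _+_ (trans (bernoulli-egf n) (sym (egf-shift-one n))) (one-⊛ (egf bernoulli) n) ⟩
  egf (shift one) n + egf bernoulli n                              ≡⟨ solve 3 (λ x y z → x :* z :+ y :* z := (y :+ x) :* z) refl (shift one n) (bernoulli n) (1/ n !) ⟩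
  egf (λ m → bernoulli m + shift one m) n                          ∎)
  where open ≡-Reasoning

binomialTransform-linear : ∀ n u v c →
  binomialTransform (λ i → u i - c * v i) n ≡ binomialTransform u n - c * binomialTransform v n
binomialTransform-linear zero    u v c = refl
binomialTransform-linear (suc n) u v c = trans
  (cong₂ _+_ (binomialTransform-linear n u v c) (binomialTransform-linear n (unshift u) (unshift v) c))
  (solve 5 (λ u u′ v v′ c → u :- c :* v :+ (u′ :- c :* v′) := u :+ u′ :- c :* (v :+ v′)) refl
    (binomialTransform u n) (binomialTransform (unshift u) n) (binomialTransform v n) (binomialTransform (unshift v) n) c)

-- In terms of moments, falling k a i is L(xⁱ · x (x - 1) ⋯ (x - k + 1)).
falling : ℕ → Series → Series
falling zero    a   = a
falling (suc k) a i = falling k a (suc i) - ι k * falling k a i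

falling-+ : ∀ k a c i → falling k (λ j → a j + c j) i ≡ falling k a i + falling k c i
falling-+ zero    a c i = refl
falling-+ (suc k) a c i = trans
  (cong₂ (λ x y → x - ι k * y) (falling-+ k a c (suc i)) (falling-+ k a c i))
  (solve 5 (λ a a′ c c′ k → a :+ c :- k :* (a′ :+ c′) := a :- k :* a′ :+ (c :- k :* c′)) refl
    (falling k a (suc i)) (falling k a i) (falling k c (suc i)) (falling k c i) (ι k))

falling-cong : ∀ k {a c} → a ≗ c → falling k a ≗ falling k c
falling-cong zero    a≗c i = a≗c i
falling-cong (suc k) a≗c i = cong₂ (λ x y → x - ι k * y) (falling-cong k a≗c (suc i)) (falling-cong k a≗c i)

falling-unshift : ∀ k a i → falling k a (suc i) ≡ falling k (unshift a) i
falling-unshift zero    a i = refl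
falling-unshift (suc k) a i = cong₂ (λ x y → x - ι k * y) (falling-unshift k a (suc i)) (falling-unshift k a i)

-- `one` is the moment sequence of f ↦ f(0), and a multiple of x vanishes at 0.
falling-one-suc : ∀ k i → falling k one (suc i) ≡ 0ℚ
falling-one-suc zero    i = refl
falling-one-suc (suc k) i = trans
  (cong₂ (λ x y → x - ι k * y) (falling-one-suc k (suc i)) (falling-one-suc k i))
  (solve 1 (λ k → con 0ℚ :- k :* con 0ℚ := con 0ℚ) refl (ι k))

falling-suc-one : ∀ k → falling (suc k) one 0 ≡ 0ℚ
falling-suc-one zero    = refl
falling-suc-one (suc k) = trans
  (cong₂ (λ x y → x - ι (suc k) * y) (falling-one-suc (suc k) 0) (falling-suc-one k))
  (solve 1 (λ k → con 0ℚ :- k :* con 0ℚ := con 0ℚ) refl (ι (suc k)))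

-- Product rule at 0 for (x)ₖ₊₂ = (x)ₖ₊₁ (x - k - 1), whose first factor vanishes there.
falling-shift-one : ∀ k → falling (suc (suc k)) (shift one) 0 ≡ - (ι (suc k) * falling (suc k) (shift one) 0)
falling-shift-one k = trans
  (cong (_- ι (suc k) * falling (suc k) (shift one) 0)
    (trans (falling-unshift (suc k) (shift one) 0) (falling-suc-one k)))
  (+-identityˡ _)

-- The difference equation (x + 1)ₖ₊₁ = (x)ₖ₊₁ + (k + 1) (x)ₖ for falling factorials.
falling-binomialTransform : ∀ k a i → falling (suc k) (binomialTransform a) i ≡
  binomialTransform (falling (suc k) a) i + ι (suc k) * binomialTransform (falling k a) i
falling-binomialTransform zero    a i = begin
  E a i + E (unshift a) i - 0ℚ * E a i
    ≡⟨ solve 2 (λ x y → x :+ y :- con 0ℚ :* x := y :- con 0ℚ :* x :+ con 1ℚ :* x) refl (E a i) (E (unshift a) i) ⟩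
  E (unshift a) i - 0ℚ * E a i + 1ℚ * E a i
    ≡⟨ cong (_+ 1ℚ * E a i) (binomialTransform-linear i (unshift a) a 0ℚ) ⟨
  E (falling 1 a) i + 1ℚ * E a i ∎
  where
  open ≡-Reasoning
  E = binomialTransform
falling-binomialTransform (suc k) a i = begin
  falling (suc k) (E a) (suc i) - c * falling (suc k) (E a) i
    ≡⟨ cong₂ (λ x y → x - c * y) (falling-binomialTransform k a (suc i)) (falling-binomialTransform k a i) ⟩
  (E u i + E (unshift u) i + c * (E v i + E (unshift v) i)) - c * (E u i + c * E v i)
    -- Only the `E u i` in the subtracted part is expanded; then all terms in `v` cancel.
    ≡⟨ cong (λ x → (E u i + E (unshift u) i + c * (E v i + E (unshift v) i)) - c * (x + c * E v i)) Eu ⟩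
  (E u i + E (unshift u) i + c * (E v i + E (unshift v) i)) - c * (E (unshift v) i - ι k * E v i + c * E v i)
    ≡⟨ cong (λ c → (E u i + E (unshift u) i + c * (E v i + E (unshift v) i)) - c * (E (unshift v) i - ι k * E v i + c * E v i)) (ι-suc k) ⟩
  (E u i + E (unshift u) i + (ι k + 1ℚ) * (E v i + E (unshift v) i)) - (ι k + 1ℚ) * (E (unshift v) i - ι k * E v i + (ι k + 1ℚ) * E v i)
    ≡⟨ solve 5 (λ u u′ v v′ k → (u :+ u′ :+ (k :+ con 1ℚ) :* (v :+ v′)) :- (k :+ con 1ℚ) :* (v′ :- k :* v :+ (k :+ con 1ℚ) :* v)
         := u′ :- (k :+ con 1ℚ) :* u :+ (k :+ con 1ℚ :+ con 1ℚ) :* u) refl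
         (E u i) (E (unshift u) i) (E v i) (E (unshift v) i) (ι k) ⟩
  E (unshift u) i - (ι k + 1ℚ) * E u i + (ι k + 1ℚ + 1ℚ) * E u i
    ≡⟨ cong₂ (λ x y → E (unshift u) i - x * E u i + y * E u i) (ι-suc k) (trans (ι-suc (suc k)) (cong (_+ 1ℚ) (ι-suc k))) ⟨
  E (unshift u) i - c * E u i + ι (suc (suc k)) * E u i
    ≡⟨ cong (_+ ι (suc (suc k)) * E u i) (binomialTransform-linear i (unshift u) u c) ⟨
  E (falling (suc (suc k)) a) i + ι (suc (suc k)) * E u i ∎
  where
  open ≡-Reasoning
  E = binomialTransform
  c = ι (suc k)
  u = falling (suc k) a
  v = falling k a
  Eu : E u i ≡ E (unshift v) i - ι k * E v i
  Eu = binomialTransform-linear i (unshift v) v (ι k)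

-- L(f(x + 1)) = L(f) + f′(0) for f = (x)ₖ₊₁: the difference equation turns the left side into L(f)
-- + (k + 1) L((x)ₖ), and L(f) cancels.
falling-bernoulli : ∀ k → ι (suc k) * falling k bernoulli 0 ≡ falling (suc k) (shift one) 0
falling-bernoulli k = +-cancelˡ (falling (suc k) bernoulli 0) (begin
  falling (suc k) bernoulli 0 + ι (suc k) * falling k bernoulli 0    ≡⟨ falling-binomialTransform k bernoulli 0 ⟨
  falling (suc k) (binomialTransform bernoulli) 0                    ≡⟨ falling-cong (suc k) binomialTransform-bernoulli 0 ⟩
  falling (suc k) (λ j → bernoulli j + shift one j) 0                ≡⟨ falling-+ (suc k) bernoulli (shift one) 0 ⟩
  falling (suc k) bernoulli 0 + falling (suc k) (shift one) 0        ∎)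
  where
  open ≡-Reasoning
  +-cancelˡ : ∀ x {y z} → x + y ≡ x + z → y ≡ z
  +-cancelˡ x {y} {z} eq = trans (sym (minus y)) (trans (cong (_- x) eq) (minus z))
    where
    minus : ∀ y → x + y - x ≡ y
    minus = solve 2 (λ x y → x :+ y :- x := y) refl x

-- The quotient of consecutive values of L((x)ₖ) = (-1)ᵏ k! / (k + 1), cleared of denominators.
falling-bernoulli-suc : ∀ k → (ι k + 1ℚ + 1ℚ) * falling (suc k) bernoulli 0 ≡
  - ((ι k + 1ℚ) * (ι k + 1ℚ) * falling k bernoulli 0)
falling-bernoulli-suc k = begin
  (ι k + 1ℚ + 1ℚ) * falling (suc k) bernoulli 0    ≡⟨ cong (_* falling (suc k) bernoulli 0) (trans (ι-suc (suc k)) (cong (_+ 1ℚ) (ι-suc k))) ⟨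
  ι (suc (suc k)) * falling (suc k) bernoulli 0    ≡⟨ falling-bernoulli (suc k) ⟩
  falling (suc (suc k)) (shift one) 0              ≡⟨ falling-shift-one k ⟩
  - (ι (suc k) * falling (suc k) (shift one) 0)    ≡⟨ cong (λ x → - (ι (suc k) * x)) (falling-bernoulli k) ⟨
  - (ι (suc k) * (ι (suc k) * falling k bernoulli 0))
    ≡⟨ cong (λ x → - (x * (x * falling k bernoulli 0))) (ι-suc k) ⟩
  - ((ι k + 1ℚ) * ((ι k + 1ℚ) * falling k bernoulli 0))
    ≡⟨ cong -_ (*-assoc (ι k + 1ℚ) (ι k + 1ℚ) (falling k bernoulli 0)) ⟨
  - ((ι k + 1ℚ) * (ι k + 1ℚ) * falling k bernoulli 0) ∎
  where open ≡-Reasoning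

-- Touchard polynomials

-- L(f) for the polynomial f of degree less than N and the functional L with moments a.
pairing : ℕ → Series → Series → ℚ
pairing N f a = ∑[ j < N ] (f (toℕ j) * a (toℕ j))

pairing-congʳ : ∀ N f {a c} → a ≗ c → pairing N f a ≡ pairing N f c
pairing-congʳ N f a≗c = sum-cong-≗ {N} λ j → cong (f (toℕ j) *_) (a≗c (toℕ j))

pairing-linearʳ : ∀ N f a c x → pairing N f (λ j → a j + x * c j) ≡ pairing N f a + x * pairing N f c
pairing-linearʳ zero    f a c x = solve 1 (λ x → con 0ℚ := con 0ℚ :+ x :* con 0ℚ) refl x
pairing-linearʳ (suc N) f a c x = trans
  (cong (λ s → f 0 * (a 0 + x * c 0) + s) (pairing-linearʳ N (unshift f) (unshift a) (unshift c) x))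
  (solve 6 (λ f a c x s t → f :* (a :+ x :* c) :+ (s :+ x :* t) := f :* a :+ s :+ x :* (f :* c :+ t)) refl
    (f 0) (a 0) (c 0) x (pairing N (unshift f) (unshift a)) (pairing N (unshift f) (unshift c)))

pairing-extend : ∀ N f a → f N ≡ 0ℚ → pairing (suc N) f a ≡ pairing N f a
pairing-extend zero    f a f≡0 = trans (cong (λ x → x * a 0 + 0ℚ) f≡0) (solve 1 (λ x → con 0ℚ :* x :+ con 0ℚ := con 0ℚ) refl (a 0))
pairing-extend (suc N) f a f≡0 = cong (λ s → f 0 * a 0 + s) (pairing-extend N (unshift f) (unshift a) f≡0)

pairing-shift : ∀ N f a → pairing (suc N) (shift f) a ≡ pairing N f (unshift a)
pairing-shift N f a = trans (cong (_+ pairing N f (unshift a)) (*-zeroˡ (a 0))) (+-identityˡ _)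

-- The coefficients of (2 n + 1) (2 x + 1) f + n⁴ g.
recurrence : ℚ → Series → Series → Series
recurrence n f g j = (n + n + 1ℚ) * (shift f j + shift f j + f j) + n * n * n * n * g j

-- Multiplying a polynomial by x is dual to `unshift` on the moments.
pairing-recurrence : ∀ N n f g a → f N ≡ 0ℚ → pairing (suc N) (recurrence n f g) a ≡
  (n + n + 1ℚ) * (pairing N f (unshift a) + pairing N f (unshift a) + pairing N f a)
    + n * n * n * n * pairing (suc N) g a
pairing-recurrence N n f g a fN≡0 = begin
  pairing (suc N) (recurrence n f g) a
    ≡⟨ linear (suc N) (shift f) f g a ⟩
  (n + n + 1ℚ) * (pairing (suc N) (shift f) a + pairing (suc N) (shift f) a + pairing (suc N) f a)
    + n * n * n * n * pairing (suc N) g a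
    ≡⟨ cong₂ (λ s t → (n + n + 1ℚ) * (s + s + t) + n * n * n * n * pairing (suc N) g a)
         (pairing-shift N f a) (pairing-extend N f a fN≡0) ⟩
  (n + n + 1ℚ) * (pairing N f (unshift a) + pairing N f (unshift a) + pairing N f a)
    + n * n * n * n * pairing (suc N) g a ∎
  where
  open ≡-Reasoning
  -- `shift f` is generalised to an arbitrary `s`, because the induction drops the head of every
  -- sequence and `unshift (shift f)` is no longer a `shift`.
  linear : ∀ N s f g a →
    pairing N (λ j → (n + n + 1ℚ) * (s j + s j + f j) + n * n * n * n * g j) a ≡
    (n + n + 1ℚ) * (pairing N s a + pairing N s a + pairing N f a) + n * n * n * n * pairing N g a
  linear zero    s f g a = solve 1 (λ n → con 0ℚ :=
    (n :+ n :+ con 1ℚ) :* (con 0ℚ :+ con 0ℚ :+ con 0ℚ) :+ n :* n :* n :* n :* con 0ℚ) refl n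
  linear (suc N) s f g a = trans
    (cong (λ r → ((n + n + 1ℚ) * (s 0 + s 0 + f 0) + n * n * n * n * g 0) * a 0 + r)
      (linear N (unshift s) (unshift f) (unshift g) (unshift a)))
    (solve 8 (λ n s f g a s′ f′ g′ →
        ((n :+ n :+ con 1ℚ) :* (s :+ s :+ f) :+ n :* n :* n :* n :* g) :* a
          :+ ((n :+ n :+ con 1ℚ) :* (s′ :+ s′ :+ f′) :+ n :* n :* n :* n :* g′)
        := (n :+ n :+ con 1ℚ) :* (s :* a :+ s′ :+ (s :* a :+ s′) :+ (f :* a :+ f′)) :+ n :* n :* n :* n :* (g :* a :+ g′)) refl
      n (s 0) (f 0) (g 0) (a 0) (pairing N (unshift s) (unshift a)) (pairing N (unshift f) (unshift a)) (pairing N (unshift g) (unshift a)))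

-- n!² times the n-th Touchard polynomial Σₖ C(n,k) C(n+k,k) C(x,k).
touchard : ℕ → Series
touchard zero          = one
touchard (suc zero)    = recurrence 0ℚ one (λ _ → 0ℚ)
touchard (suc (suc n)) = recurrence (ι (suc n)) (touchard (suc n)) (touchard n)

recurrence-zero : ∀ n f g j → shift f j ≡ 0ℚ → f j ≡ 0ℚ → g j ≡ 0ℚ → recurrence n f g j ≡ 0ℚ
recurrence-zero n f g j s≡0 f≡0 g≡0 = trans
  (cong₂ _+_ (cong₂ (λ s t → (n + n + 1ℚ) * (s + s + t)) s≡0 f≡0) (cong (n * n * n * n *_) g≡0))
  (solve 1 (λ n → (n :+ n :+ con 1ℚ) :* (con 0ℚ :+ con 0ℚ :+ con 0ℚ) :+ n :* n :* n :* n :* con 0ℚ := con 0ℚ) refl n)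

touchard-degree : ∀ n {j} → n ℕ.< j → touchard n j ≡ 0ℚ
touchard-degree zero          {suc j}       _         = refl
touchard-degree (suc zero)    {suc zero}    (s≤s ())
touchard-degree (suc zero)    {suc (suc j)} _         = recurrence-zero 0ℚ one (λ _ → 0ℚ) (suc (suc j)) refl refl refl
touchard-degree (suc (suc n)) {suc j}       (s≤s n<j) =
  recurrence-zero (ι (suc n)) (touchard (suc n)) (touchard n) (suc j)
    (touchard-degree (suc n) n<j) (touchard-degree (suc n) (ℕ.m<n⇒m<1+n n<j))
    (touchard-degree n (ℕ.m<n⇒m<1+n (ℕ.<-trans ℕ.≤-refl n<j)))

double-cancel : ∀ {x y} → x + x ≡ y + y → x ≡ y
double-cancel {x} {y} eq = ι-cancel 2 (trans (double x) (trans eq (sym (double y))))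
  where
  double : ∀ z → ι 2 * z ≡ z + z
  double = solve 1 (λ z → (con 1ℚ :+ con 1ℚ) :* z := z :+ z) refl

-- Each step of the recurrence multiplies the leading coefficient by 2 (2 m + 1), so it is cancelled
-- one such factor at a time. It is the factor that replacing the last Hankel row introduces.
touchard-leading-cancel : ∀ n {x y} → touchard n n * x ≡ touchard n n * y → x ≡ y
touchard-leading-cancel zero          {x} {y} eq = ι-cancel 1 eq
touchard-leading-cancel (suc zero)    {x} {y} eq = ι-cancel 2 eq
touchard-leading-cancel (suc (suc n)) {x} {y} eq =
  touchard-leading-cancel (suc n) (double-cancel (ι+ι+1-cancel (suc n) (suc n)
    (trans (sym (leading x)) (trans eq (leading y)))))
  where
  m = ι (suc n)
  l = touchard (suc n) (suc n)
  leading : ∀ z → touchard (suc (suc n)) (suc (suc n)) * z ≡ (m + m + 1ℚ) * (l * z + l * z)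
  leading z = trans
    (cong₂ (λ s t → ((m + m + 1ℚ) * (l + l + s) + m * m * m * m * t) * z)
      (touchard-degree (suc n) {suc (suc n)} ℕ.≤-refl) (touchard-degree n {suc (suc n)} (ℕ.m<n⇒m<1+n ℕ.≤-refl)))
    (solve 3 (λ m l z → ((m :+ m :+ con 1ℚ) :* (l :+ l :+ con 0ℚ) :+ m :* m :* m :* m :* con 0ℚ) :* z
      := (m :+ m :+ con 1ℚ) :* (l :* z :+ l :* z)) refl m l z)

-- Functionals at n!² Pₙ, and the product formula on falling factorials

Λ : ℕ → Series → ℚ
Λ n = pairing (suc n) (touchard n)

Λ-zero : ∀ a → Λ 0 a ≡ a 0
Λ-zero a = solve 1 (λ x → con 1ℚ :* x :+ con 0ℚ := x) refl (a 0)

Λ-one : ∀ a → Λ 1 a ≡ a 1 + a 1 + a 0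
Λ-one a = solve 2 (λ x y → con 1ℚ :* x :+ (con (1ℚ + 1ℚ) :* y :+ con 0ℚ) := y :+ y :+ x) refl (a 0) (a 1)

Λ-recurrence : ∀ n a → let m = ι (suc n) in
  Λ (suc (suc n)) a ≡ (m + m + 1ℚ) * (Λ (suc n) (unshift a) + Λ (suc n) (unshift a) + Λ (suc n) a) + m * m * m * m * Λ n a
Λ-recurrence n a = trans
  (pairing-recurrence (suc (suc n)) m (touchard (suc n)) (touchard n) a (touchard-degree (suc n) ℕ.≤-refl))
  (cong (λ x → (m + m + 1ℚ) * (Λ (suc n) (unshift a) + Λ (suc n) (unshift a) + Λ (suc n) a) + m * m * m * m * x)
    (trans (pairing-extend (suc (suc n)) (touchard n) a (touchard-degree n (ℕ.m<n⇒m<1+n ℕ.≤-refl)))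
           (pairing-extend (suc n) (touchard n) a (touchard-degree n ℕ.≤-refl))))
  where m = ι (suc n)

-- This is L(n!² Pₙ · (x)ₖ).
γ : ℕ → ℕ → ℚ
γ n k = Λ n (falling k bernoulli)

-- From x (x)ₖ = (x)ₖ₊₁ + k (x)ₖ; it turns the recurrence of the polynomials into one for `γ` alone.
Λ-unshift-falling : ∀ n k → Λ n (unshift (falling k bernoulli)) ≡ γ n (suc k) + ι k * γ n k
Λ-unshift-falling n k = trans
  (pairing-congʳ (suc n) (touchard n) λ j →
    solve 3 (λ x y k → x := x :- k :* y :+ k :* y) refl (falling k bernoulli (suc j)) (falling k bernoulli j) (ι k))
  (pairing-linearʳ (suc n) (touchard n) (falling (suc k) bernoulli) (falling k bernoulli) (ι k))

γ-one : ∀ k → γ 1 k ≡ γ 0 (suc k) + ι k * γ 0 k + (γ 0 (suc k) + ι k * γ 0 k) + γ 0 k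
γ-one k = trans (Λ-one a) (cong₂ (λ x y → x + x + y)
  (trans (sym (Λ-zero (unshift a))) (Λ-unshift-falling 0 k)) (sym (Λ-zero a)))
  where a = falling k bernoulli

γ-recurrence : ∀ n k → let m = ι (suc n) in γ (suc (suc n)) k ≡
  (m + m + 1ℚ) * (γ (suc n) (suc k) + ι k * γ (suc n) k + (γ (suc n) (suc k) + ι k * γ (suc n) k) + γ (suc n) k)
    + m * m * m * m * γ n k
γ-recurrence n k = trans (Λ-recurrence n (falling k bernoulli))
  (cong (λ x → (ι (suc n) + ι (suc n) + 1ℚ) * (x + x + γ (suc n) k) + ι (suc n) * ι (suc n) * ι (suc n) * ι (suc n) * γ n k)
    (Λ-unshift-falling (suc n) k))

γ-zero-suc : ∀ k → (ι k + 1ℚ + 1ℚ) * γ 0 (suc k) ≡ - ((ι k + 1ℚ) * (ι k + 1ℚ) * γ 0 k)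
γ-zero-suc k = begin
  (ι k + 1ℚ + 1ℚ) * γ 0 (suc k)                         ≡⟨ cong ((ι k + 1ℚ + 1ℚ) *_) (Λ-zero (falling (suc k) bernoulli)) ⟩
  (ι k + 1ℚ + 1ℚ) * falling (suc k) bernoulli 0         ≡⟨ falling-bernoulli-suc k ⟩
  - ((ι k + 1ℚ) * (ι k + 1ℚ) * falling k bernoulli 0)   ≡⟨ cong (λ x → - ((ι k + 1ℚ) * (ι k + 1ℚ) * x)) (Λ-zero (falling k bernoulli)) ⟨
  - ((ι k + 1ℚ) * (ι k + 1ℚ) * γ 0 k)                   ∎
  where open ≡-Reasoning

-- Both relations say γ n k = (-1)ᵏ n!² k!³ / ((k - n)! (k + n + 1)!). Both are needed in the
-- induction on n: the recurrence for γ (n + 2) k involves γ (n + 1) (k + 1) and γ (n + 1) k.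
Ratioₙ Ratioₙₖ : ℕ → Set
Ratioₙ n = ∀ k → (ι k + ι (suc n) + 1ℚ) * γ (suc n) k ≡ ι (suc n) * ι (suc n) * (ι k + 1ℚ - ι (suc n)) * γ n k
Ratioₙₖ n = ∀ k → (ι k + ι (suc n) + 1ℚ) * ((ι k + ι (suc n) + 1ℚ + 1ℚ) * γ (suc n) (suc k)) ≡
  - (ι (suc n) * ι (suc n) * ((ι k + 1ℚ) * (ι k + 1ℚ) * (ι k + 1ℚ)) * γ n k)

ratioₙ-zero : Ratioₙ 0
ratioₙ-zero k = begin
  (K + 1ℚ + 1ℚ) * γ 1 k                               ≡⟨ cong ((K + 1ℚ + 1ℚ) *_) (γ-one k) ⟩
  (K + 1ℚ + 1ℚ) * (g′ + K * g + (g′ + K * g) + g)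
    ≡⟨ solve 3 (λ K g g′ → (K :+ con 1ℚ :+ con 1ℚ) :* (g′ :+ K :* g :+ (g′ :+ K :* g) :+ g)
         := (K :+ con 1ℚ :+ con 1ℚ) :* g′ :+ (K :+ con 1ℚ :+ con 1ℚ) :* g′ :+ (K :+ con 1ℚ :+ con 1ℚ) :* ((K :+ K :+ con 1ℚ) :* g)) refl K g g′ ⟩
  (K + 1ℚ + 1ℚ) * g′ + (K + 1ℚ + 1ℚ) * g′ + (K + 1ℚ + 1ℚ) * ((K + K + 1ℚ) * g)
    ≡⟨ cong (λ x → x + x + (K + 1ℚ + 1ℚ) * ((K + K + 1ℚ) * g)) (γ-zero-suc k) ⟩
  - ((K + 1ℚ) * (K + 1ℚ) * g) + - ((K + 1ℚ) * (K + 1ℚ) * g) + (K + 1ℚ + 1ℚ) * ((K + K + 1ℚ) * g)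
    ≡⟨ solve 2 (λ K g → :- ((K :+ con 1ℚ) :* (K :+ con 1ℚ) :* g) :+ :- ((K :+ con 1ℚ) :* (K :+ con 1ℚ) :* g)
           :+ (K :+ con 1ℚ :+ con 1ℚ) :* ((K :+ K :+ con 1ℚ) :* g)
         := con 1ℚ :* con 1ℚ :* (K :+ con 1ℚ :- con 1ℚ) :* g) refl K g ⟩
  1ℚ * 1ℚ * (K + 1ℚ - 1ℚ) * g                         ∎
  where
  open ≡-Reasoning
  K = ι k
  g = γ 0 k
  g′ = γ 0 (suc k)

ratioₙₖ-zero : Ratioₙₖ 0
ratioₙₖ-zero k = begin
  (K + 1ℚ + 1ℚ) * ((K + 1ℚ + 1ℚ + 1ℚ) * γ 1 (suc k))    ≡⟨ cong (λ x → (K + 1ℚ + 1ℚ) * ((x + 1ℚ + 1ℚ) * γ 1 (suc k))) (ι-suc k) ⟨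
  (K + 1ℚ + 1ℚ) * ((ι (suc k) + 1ℚ + 1ℚ) * γ 1 (suc k)) ≡⟨ cong ((K + 1ℚ + 1ℚ) *_) (ratioₙ-zero (suc k)) ⟩
  (K + 1ℚ + 1ℚ) * (1ℚ * 1ℚ * (ι (suc k) + 1ℚ - 1ℚ) * g′)
    ≡⟨ cong (λ x → (K + 1ℚ + 1ℚ) * (1ℚ * 1ℚ * (x + 1ℚ - 1ℚ) * g′)) (ι-suc k) ⟩
  (K + 1ℚ + 1ℚ) * (1ℚ * 1ℚ * (K + 1ℚ + 1ℚ - 1ℚ) * g′)
    ≡⟨ solve 2 (λ K g′ → (K :+ con 1ℚ :+ con 1ℚ) :* (con 1ℚ :* con 1ℚ :* (K :+ con 1ℚ :+ con 1ℚ :- con 1ℚ) :* g′)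
         := (K :+ con 1ℚ) :* ((K :+ con 1ℚ :+ con 1ℚ) :* g′)) refl K g′ ⟩
  (K + 1ℚ) * ((K + 1ℚ + 1ℚ) * g′)                       ≡⟨ cong ((K + 1ℚ) *_) (γ-zero-suc k) ⟩
  (K + 1ℚ) * - ((K + 1ℚ) * (K + 1ℚ) * g)
    ≡⟨ solve 2 (λ K g → (K :+ con 1ℚ) :* :- ((K :+ con 1ℚ) :* (K :+ con 1ℚ) :* g)
         := :- (con 1ℚ :* con 1ℚ :* ((K :+ con 1ℚ) :* (K :+ con 1ℚ) :* (K :+ con 1ℚ)) :* g)) refl K g ⟩
  - (1ℚ * 1ℚ * ((K + 1ℚ) * (K + 1ℚ) * (K + 1ℚ)) * g)    ∎
  where
  open ≡-Reasoning
  K = ι k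
  g = γ 0 k
  g′ = γ 0 (suc k)

-- After multiplication by `e`, both hypotheses apply to the recurrence and leave a multiple of
-- `γ n k`. Its polynomial coefficient contains the factor m² (k + 1 - m), with which `rₙ` leads
-- back to `e` times `γ (suc n) k`.
ratioₙ-suc : ∀ n → Ratioₙ n → Ratioₙₖ n → Ratioₙ (suc n)
ratioₙ-suc n rₙ rₙₖ k = ι+ι+1-cancel k (suc n) (begin
  e * ((K + ι (suc (suc n)) + 1ℚ) * γ (suc (suc n)) k)
    ≡⟨ cong₂ (λ x y → e * ((K + x + 1ℚ) * y)) (ι-suc (suc n)) (γ-recurrence n k) ⟩
  e * ((K + (m + 1ℚ) + 1ℚ) * ((m + m + 1ℚ) * (g₁′ + K * g₁ + (g₁′ + K * g₁) + g₁) + m * m * m * m * g₀))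
    ≡⟨ solve 5 (λ K m g₀ g₁ g₁′ → let e = K :+ m :+ con 1ℚ in
         e :* ((K :+ (m :+ con 1ℚ) :+ con 1ℚ) :* ((m :+ m :+ con 1ℚ) :* (g₁′ :+ K :* g₁ :+ (g₁′ :+ K :* g₁) :+ g₁) :+ m :* m :* m :* m :* g₀))
         := (m :+ m :+ con 1ℚ) :* (e :* ((e :+ con 1ℚ) :* g₁′) :+ e :* ((e :+ con 1ℚ) :* g₁′) :+ (K :+ K :+ con 1ℚ) :* (e :+ con 1ℚ) :* (e :* g₁))
            :+ e :* (e :+ con 1ℚ) :* (m :* m :* m :* m :* g₀)) refl K m g₀ g₁ g₁′ ⟩
  (m + m + 1ℚ) * (e * ((e + 1ℚ) * g₁′) + e * ((e + 1ℚ) * g₁′) + (K + K + 1ℚ) * (e + 1ℚ) * (e * g₁))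
    + e * (e + 1ℚ) * (m * m * m * m * g₀)
    ≡⟨ cong₂ (λ x y → (m + m + 1ℚ) * (x + x + (K + K + 1ℚ) * (e + 1ℚ) * y) + e * (e + 1ℚ) * (m * m * m * m * g₀)) (rₙₖ k) (rₙ k) ⟩
  (m + m + 1ℚ) * (- (m * m * ((K + 1ℚ) * (K + 1ℚ) * (K + 1ℚ)) * g₀) + - (m * m * ((K + 1ℚ) * (K + 1ℚ) * (K + 1ℚ)) * g₀)
      + (K + K + 1ℚ) * (e + 1ℚ) * (m * m * (K + 1ℚ - m) * g₀)) + e * (e + 1ℚ) * (m * m * m * m * g₀)
    ≡⟨ solve 3 (λ K m g₀ → let e = K :+ m :+ con 1ℚ ; c = m :* m :* ((K :+ con 1ℚ) :* (K :+ con 1ℚ) :* (K :+ con 1ℚ)) :* g₀ in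
         (m :+ m :+ con 1ℚ) :* (:- c :+ :- c :+ (K :+ K :+ con 1ℚ) :* (e :+ con 1ℚ) :* (m :* m :* (K :+ con 1ℚ :- m) :* g₀))
           :+ e :* (e :+ con 1ℚ) :* (m :* m :* m :* m :* g₀)
         := (m :+ con 1ℚ) :* (m :+ con 1ℚ) :* (K :+ con 1ℚ :- (m :+ con 1ℚ)) :* (m :* m :* (K :+ con 1ℚ :- m) :* g₀)) refl K m g₀ ⟩
  (m + 1ℚ) * (m + 1ℚ) * (K + 1ℚ - (m + 1ℚ)) * (m * m * (K + 1ℚ - m) * g₀)
    ≡⟨ cong ((m + 1ℚ) * (m + 1ℚ) * (K + 1ℚ - (m + 1ℚ)) *_) (rₙ k) ⟨
  (m + 1ℚ) * (m + 1ℚ) * (K + 1ℚ - (m + 1ℚ)) * (e * g₁)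
    ≡⟨ solve 3 (λ x e g → x :* (e :* g) := e :* (x :* g)) refl ((m + 1ℚ) * (m + 1ℚ) * (K + 1ℚ - (m + 1ℚ))) e g₁ ⟩
  e * ((m + 1ℚ) * (m + 1ℚ) * (K + 1ℚ - (m + 1ℚ)) * g₁)
    ≡⟨ cong (λ x → e * (x * x * (K + 1ℚ - x) * g₁)) (ι-suc (suc n)) ⟨
  e * (ι (suc (suc n)) * ι (suc (suc n)) * (K + 1ℚ - ι (suc (suc n))) * g₁) ∎)
  where
  open ≡-Reasoning
  K = ι k
  m = ι (suc n)
  e = K + m + 1ℚ
  g₀ = γ n k
  g₁ = γ (suc n) k
  g₁′ = γ (suc n) (suc k)

-- The chain runs from `γ (suc (suc n)) (suc k)` to `γ (suc n) (suc k)` by the new relation at k +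
-- 1, diagonally down to `γ n k` by `rₙₖ`, and up to `γ (suc n) k` by `rₙ` reversed.
ratioₙₖ-suc : ∀ n → Ratioₙ n → Ratioₙₖ n → Ratioₙₖ (suc n)
ratioₙₖ-suc n rₙ rₙₖ k = ι+ι+1-cancel k (suc n) (begin
  e * ((K + ι (suc (suc n)) + 1ℚ) * ((K + ι (suc (suc n)) + 1ℚ + 1ℚ) * g₂′))
    ≡⟨ cong (λ x → e * ((K + ι (suc (suc n)) + 1ℚ) * (x * g₂′)))
         (trans (solve 2 (λ K m → K :+ m :+ con 1ℚ :+ con 1ℚ := K :+ con 1ℚ :+ m :+ con 1ℚ) refl K (ι (suc (suc n))))
           (cong (λ x → x + ι (suc (suc n)) + 1ℚ) (sym (ι-suc k)))) ⟩
  e * ((K + ι (suc (suc n)) + 1ℚ) * ((ι (suc k) + ι (suc (suc n)) + 1ℚ) * g₂′))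
    ≡⟨ cong (λ x → e * ((K + ι (suc (suc n)) + 1ℚ) * x)) (ratioₙ-suc n rₙ rₙₖ (suc k)) ⟩
  e * ((K + ι (suc (suc n)) + 1ℚ) * (ι (suc (suc n)) * ι (suc (suc n)) * (ι (suc k) + 1ℚ - ι (suc (suc n))) * g₁′))
    ≡⟨ cong₂ (λ x y → e * ((K + x + 1ℚ) * (x * x * (y + 1ℚ - x) * g₁′))) (ι-suc (suc n)) (ι-suc k) ⟩
  e * ((K + (m + 1ℚ) + 1ℚ) * ((m + 1ℚ) * (m + 1ℚ) * (K + 1ℚ + 1ℚ - (m + 1ℚ)) * g₁′))
    ≡⟨ solve 3 (λ K m g₁′ → let e = K :+ m :+ con 1ℚ in
         e :* ((K :+ (m :+ con 1ℚ) :+ con 1ℚ) :* ((m :+ con 1ℚ) :* (m :+ con 1ℚ) :* (K :+ con 1ℚ :+ con 1ℚ :- (m :+ con 1ℚ)) :* g₁′))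
         := (m :+ con 1ℚ) :* (m :+ con 1ℚ) :* (K :+ con 1ℚ :- m) :* (e :* ((e :+ con 1ℚ) :* g₁′))) refl K m g₁′ ⟩
  (m + 1ℚ) * (m + 1ℚ) * (K + 1ℚ - m) * (e * ((e + 1ℚ) * g₁′))
    ≡⟨ cong ((m + 1ℚ) * (m + 1ℚ) * (K + 1ℚ - m) *_) (rₙₖ k) ⟩
  (m + 1ℚ) * (m + 1ℚ) * (K + 1ℚ - m) * - (m * m * c * g₀)
    ≡⟨ solve 4 (λ K m c g₀ → (m :+ con 1ℚ) :* (m :+ con 1ℚ) :* (K :+ con 1ℚ :- m) :* :- (m :* m :* c :* g₀)
         := :- ((m :+ con 1ℚ) :* (m :+ con 1ℚ) :* c :* (m :* m :* (K :+ con 1ℚ :- m) :* g₀))) refl K m c g₀ ⟩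
  - ((m + 1ℚ) * (m + 1ℚ) * c * (m * m * (K + 1ℚ - m) * g₀))
    ≡⟨ cong (λ x → - ((m + 1ℚ) * (m + 1ℚ) * c * x)) (rₙ k) ⟨
  - ((m + 1ℚ) * (m + 1ℚ) * c * (e * g₁))
    ≡⟨ solve 3 (λ x e g → :- (x :* (e :* g)) := e :* :- (x :* g)) refl ((m + 1ℚ) * (m + 1ℚ) * c) e g₁ ⟩
  e * - ((m + 1ℚ) * (m + 1ℚ) * c * g₁)
    ≡⟨ cong (λ x → e * - (x * x * c * g₁)) (ι-suc (suc n)) ⟨
  e * - (ι (suc (suc n)) * ι (suc (suc n)) * c * g₁) ∎)
  where
  open ≡-Reasoning
  K = ι k
  m = ι (suc n)
  e = K + m + 1ℚ
  c = (K + 1ℚ) * (K + 1ℚ) * (K + 1ℚ)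
  g₀ = γ n k
  g₁ = γ (suc n) k
  g₁′ = γ (suc n) (suc k)
  g₂′ = γ (suc (suc n)) (suc k)

ratios : ∀ n → Ratioₙ n × Ratioₙₖ n
ratios zero    = ratioₙ-zero , ratioₙₖ-zero
ratios (suc n) = let rₙ , rₙₖ = ratios n in ratioₙ-suc n rₙ rₙₖ , ratioₙₖ-suc n rₙ rₙₖ

-- At k = 0 the relation `Ratioₙ` has the factor 1 - m = - n. It vanishes for n = 0, and from there
-- on the zero is passed from each index to the next.
Λ-bernoulli : ∀ n → Λ (suc n) bernoulli ≡ 0ℚ
Λ-bernoulli n = ι+ι+1-cancel 0 (suc n) (begin
  (0ℚ + m + 1ℚ) * γ (suc n) 0                ≡⟨ proj₁ (ratios n) 0 ⟩
  m * m * (0ℚ + 1ℚ - m) * γ n 0              ≡⟨ vanishes n ⟩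
  0ℚ                                         ≡⟨ *-zeroʳ (0ℚ + m + 1ℚ) ⟨
  (0ℚ + m + 1ℚ) * 0ℚ                         ∎)
  where
  open ≡-Reasoning
  m = ι (suc n)
  vanishes : ∀ n → ι (suc n) * ι (suc n) * (0ℚ + 1ℚ - ι (suc n)) * γ n 0 ≡ 0ℚ
  vanishes zero    = *-zeroˡ (γ 0 0)
  vanishes (suc n) = trans (cong (ι (suc (suc n)) * ι (suc (suc n)) * (0ℚ + 1ℚ - ι (suc (suc n))) *_) (Λ-bernoulli n))
    (*-zeroʳ (ι (suc (suc n)) * ι (suc (suc n)) * (0ℚ + 1ℚ - ι (suc (suc n)))))

-- The values L(xⁱ · n!² Pₙ): orthogonality and the diagonal

μ : ℕ → ℕ → ℚ
μ n i = Λ n (λ j → bernoulli (j ℕ.+ i))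

Λ-cong : ∀ n {a c} → a ≗ c → Λ n a ≡ Λ n c
Λ-cong n = pairing-congʳ (suc n) (touchard n)

μ-suc : ∀ n i → Λ n (unshift (λ j → bernoulli (j ℕ.+ i))) ≡ μ n (suc i)
μ-suc n i = Λ-cong n (λ j → cong bernoulli (sym (ℕ.+-suc j i)))

μ-recurrence : ∀ n i → let m = ι (suc n) in
  μ (suc (suc n)) i ≡ (m + m + 1ℚ) * (μ (suc n) (suc i) + μ (suc n) (suc i) + μ (suc n) i) + m * m * m * m * μ n i
μ-recurrence n i = trans (Λ-recurrence n (λ j → bernoulli (j ℕ.+ i)))
  (cong (λ x → (ι (suc n) + ι (suc n) + 1ℚ) * (x + x + μ (suc n) i) + ι (suc n) * ι (suc n) * ι (suc n) * ι (suc n) * μ n i)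
    (μ-suc (suc n) i))

-- Solved for its x-term, the recurrence expresses `μ n (suc i)` by the values at i for n - 1, n and
-- n + 1. So everything follows from the case i = 0, and the strict bound is just enough for the
-- index n - 1.
μ≡0 : ∀ i n → i ℕ.< n → μ n i ≡ 0ℚ
μ≡0 zero    (suc n)       _         = trans (Λ-cong (suc n) λ j → cong bernoulli (ℕ.+-identityʳ j)) (Λ-bernoulli n)
μ≡0 (suc i) (suc zero)    (s≤s ())
μ≡0 (suc i) (suc (suc n)) (s≤s i<n) = double-cancel (ι+ι+1-cancel (suc (suc n)) (suc (suc n)) (begin
  c * (x + x)                             ≡⟨ solve 3 (λ c m x → c :* (x :+ x) := c :* (x :+ x :+ con 0ℚ) :+ m :* con 0ℚ) refl c m⁴ x ⟩
  c * (x + x + 0ℚ) + m⁴ * 0ℚ              ≡⟨ cong₂ (λ y z → c * (x + x + y) + m⁴ * z)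
                                               (μ≡0 i (suc (suc n)) (ℕ.m<n⇒m<1+n i<n)) (μ≡0 i (suc n) i<n) ⟨
  c * (x + x + μ (suc (suc n)) i) + m⁴ * μ (suc n) i
                                          ≡⟨ μ-recurrence (suc n) i ⟨
  μ (suc (suc (suc n))) i                 ≡⟨ μ≡0 i (suc (suc (suc n))) (ℕ.m<n⇒m<1+n (ℕ.m<n⇒m<1+n i<n)) ⟩
  0ℚ                                      ≡⟨ *-zeroʳ c ⟨
  c * (0ℚ + 0ℚ)                           ∎))
  where
  open ≡-Reasoning
  m = ι (suc (suc n))
  c = m + m + 1ℚ
  m⁴ = m * m * m * m
  x = μ (suc (suc n)) (suc i)

-- In the recurrence at i = n, orthogonality removes all but the two diagonal values.
μ-diagonal-suc : ∀ n → let m = ι (suc n) in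
  (m + m + 1ℚ) * (μ (suc n) (suc n) + μ (suc n) (suc n)) ≡ - (m * m * m * m * μ n n)
μ-diagonal-suc n = begin
  c * (x + x)                                              ≡⟨ solve 3 (λ c x y → c :* (x :+ x) := c :* (x :+ x :+ con 0ℚ) :+ y :- y) refl c x (m⁴ * μ n n) ⟩
  c * (x + x + 0ℚ) + m⁴ * μ n n - m⁴ * μ n n               ≡⟨ cong (λ y → c * (x + x + y) + m⁴ * μ n n - m⁴ * μ n n) (μ≡0 n (suc n) ℕ.≤-refl) ⟨
  c * (x + x + μ (suc n) n) + m⁴ * μ n n - m⁴ * μ n n      ≡⟨ cong (_- m⁴ * μ n n) (μ-recurrence n n) ⟨
  μ (suc (suc n)) n - m⁴ * μ n n                           ≡⟨ cong (_- m⁴ * μ n n) (μ≡0 n (suc (suc n)) (ℕ.m<n⇒m<1+n ℕ.≤-refl)) ⟩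
  0ℚ - m⁴ * μ n n                                          ≡⟨ +-identityˡ (- (m⁴ * μ n n)) ⟩
  - (m⁴ * μ n n)                                           ∎
  where
  open ≡-Reasoning
  m = ι (suc n)
  c = m + m + 1ℚ
  m⁴ = m * m * m * m
  x = μ (suc n) (suc n)

ε : ℕ → ℚ
ε n = (- 1ℚ) ^ n

ε*ε≡1 : ∀ n → ε n * ε n ≡ 1ℚ
ε*ε≡1 zero    = refl
ε*ε≡1 (suc n) = trans (solve 1 (λ s → con (- 1ℚ) :* s :* (con (- 1ℚ) :* s) := s :* s) refl (ε n)) (ε*ε≡1 n)

[2n+3]! : ∀ n → let m = ι (suc n) in
  ι ((2 ℕ.* suc n ℕ.+ 1) !) ≡ (m + m + 1ℚ) * ((m + m) * ι ((2 ℕ.* n ℕ.+ 1) !))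
[2n+3]! n = begin
  ι ((2 ℕ.* suc n ℕ.+ 1) !)                       ≡⟨ cong (λ k → ι (k !)) index ⟩
  ι (suc (suc k) !)                               ≡⟨ ι-* (suc (suc k)) (suc k !) ⟩
  ι (suc (suc k)) * ι (suc k !)                   ≡⟨ cong (ι (suc (suc k)) *_) (ι-* (suc k) (k !)) ⟩
  ι (suc (suc k)) * (ι (suc k) * ι (k !))         ≡⟨ cong₂ (λ x y → x * (y * ι (k !))) (trans (ι-suc (suc k)) (cong (_+ 1ℚ) ι[1+k])) ι[1+k] ⟩
  (m + m + 1ℚ) * ((m + m) * ι (k !))              ∎
  where
  open ≡-Reasoning
  m = ι (suc n)
  k = 2 ℕ.* n ℕ.+ 1
  index : 2 ℕ.* suc n ℕ.+ 1 ≡ suc (suc k)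
  index = cong (ℕ._+ 1) (ℕ.*-suc 2 n)
  ι[1+k] : ι (suc k) ≡ m + m
  ι[1+k] = trans (cong ι (begin
    suc (2 ℕ.* n ℕ.+ 1)        ≡⟨ ℕ.+-comm 1 _ ⟩
    2 ℕ.* n ℕ.+ 1 ℕ.+ 1        ≡⟨ ℕ.+-assoc (2 ℕ.* n) 1 1 ⟩
    2 ℕ.* n ℕ.+ 2              ≡⟨ ℕ.+-comm (2 ℕ.* n) 2 ⟩
    2 ℕ.+ 2 ℕ.* n              ≡⟨ ℕ.*-suc 2 n ⟨
    suc n ℕ.+ (suc n ℕ.+ 0)    ≡⟨ cong (suc n ℕ.+_) (ℕ.+-identityʳ (suc n)) ⟩
    suc n ℕ.+ suc n            ∎)) (ι-+ (suc n) (suc n))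

-- From m - 1 to m the diagonal value gains - m⁴ / (2 (2 m + 1)) and the factorial gains 2 m (2 m +
-- 1). The product is - m⁵, whence the sign and the fifth power.
μ-diagonal : ∀ n → let p = ι (n !) in
  ε n * (μ n n * ι ((2 ℕ.* n ℕ.+ 1) !)) ≡ p * p * p * p * p
μ-diagonal zero    = refl
μ-diagonal (suc n) = begin
  - 1ℚ * ε n * (h′ * ι ((2 ℕ.* suc n ℕ.+ 1) !))       ≡⟨ cong (λ x → - 1ℚ * ε n * (h′ * x)) ([2n+3]! n) ⟩
  - 1ℚ * ε n * (h′ * ((m + m + 1ℚ) * ((m + m) * F)))
    ≡⟨ solve 5 (λ s h m c F → con (- 1ℚ) :* s :* (h :* (c :* ((m :+ m) :* F))) := :- (s :* m :* F) :* (c :* (h :+ h))) refl (ε n) h′ m (m + m + 1ℚ) F ⟩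
  - (ε n * m * F) * ((m + m + 1ℚ) * (h′ + h′))        ≡⟨ cong (- (ε n * m * F) *_) (μ-diagonal-suc n) ⟩
  - (ε n * m * F) * - (m * m * m * m * h)
    ≡⟨ solve 4 (λ s m F h → :- (s :* m :* F) :* :- (m :* m :* m :* m :* h) := m :* m :* m :* m :* m :* (s :* (h :* F))) refl (ε n) m F h ⟩
  m * m * m * m * m * (ε n * (h * F))                 ≡⟨ cong (m * m * m * m * m *_) (μ-diagonal n) ⟩
  m * m * m * m * m * (p * p * p * p * p)
    ≡⟨ solve 2 (λ m p → m :* m :* m :* m :* m :* (p :* p :* p :* p :* p)
         := (m :* p) :* (m :* p) :* (m :* p) :* (m :* p) :* (m :* p)) refl m p ⟩
  (m * p) * (m * p) * (m * p) * (m * p) * (m * p)     ≡⟨ cong (λ x → x * x * x * x * x) (ι-* (suc n) (n !)) ⟨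
  p′ * p′ * p′ * p′ * p′                              ∎
  where
  open ≡-Reasoning
  m = ι (suc n)
  h = μ n n
  h′ = μ (suc n) (suc n)
  F = ι ((2 ℕ.* n ℕ.+ 1) !)
  p = ι (n !)
  p′ = ι (suc n !)

-- The values at bₖ and the alternating sum

1/[_]² : ℕ → ℚ
1/[ n ]² = + 1 / (suc n ℕ.^ 2)

*1/[]² : ∀ n → ι (suc n) * ι (suc n) * 1/[ n ]² ≡ 1ℚ
*1/[]² n = begin
  ι (suc n) * ι (suc n) * 1/[ n ]²          ≡⟨ cong (_* 1/[ n ]²) (ι-* (suc n) (suc n)) ⟨
  ι (suc n ℕ.* suc n) * 1/[ n ]²            ≡⟨ cong (λ k → ι (suc n ℕ.* k) * 1/[ n ]²) (ℕ.*-identityʳ (suc n)) ⟨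
  ι (suc n ℕ.^ 2) * 1/[ n ]²                ≡⟨ m/1*1/m≡1 (suc n ℕ.^ 2) ⟩
  1ℚ                                        ∎
  where open ≡-Reasoning

altHarmonic₂-suc : ∀ n → altHarmonic₂ (suc n) ≡ altHarmonic₂ n + ε n * 1/[ n ]²
altHarmonic₂-suc n = begin
  altHarmonic₂ (suc n)                                        ≡⟨ sum-init-last {n} (λ i → t (toℕ i)) ⟩
  sum {n} (λ i → t (toℕ (inject₁ i))) + t (toℕ (fromℕ n))     ≡⟨ cong₂ _+_ (sum-cong-≗ {n} (λ i → cong t (Fin.toℕ-inject₁ i))) (cong t (Fin.toℕ-fromℕ n)) ⟩
  altHarmonic₂ n + t n                                        ∎
  where
  open ≡-Reasoning
  t : ℕ → ℚ
  t i = ε i * 1/[ i ]²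

-- Because `unshift b` is `bernoulli`, the x-term of the recurrence contributes
-- `Λ (suc n) bernoulli`, which is 0. What is left is the recurrence of the partial sums, in the
-- form (m + 1)² times the new difference equals - m² times the previous one.
Λ-b : ∀ n → Λ n b ≡ ι (n !) * ι (n !) * (altHarmonic₂ n + altHarmonic₂ n)
Λ-b zero          = refl
Λ-b (suc zero)    = refl
Λ-b (suc (suc n)) = begin
  Λ (suc (suc n)) b
    ≡⟨ Λ-recurrence n b ⟩
  (m + m + 1ℚ) * (Λ (suc n) bernoulli + Λ (suc n) bernoulli + Λ (suc n) b) + m * m * m * m * Λ n b
    ≡⟨ cong₂ (λ x y → (m + m + 1ℚ) * (x + x + y) + m * m * m * m * Λ n b) (Λ-bernoulli n) (Λ-b (suc n)) ⟩
  (m + m + 1ℚ) * (0ℚ + 0ℚ + ι (suc n !) * ι (suc n !) * (altHarmonic₂ (suc n) + altHarmonic₂ (suc n))) + m * m * m * m * Λ n b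
    ≡⟨ cong₂ (λ x y → (m + m + 1ℚ) * (0ℚ + 0ℚ + x * x * (altHarmonic₂ (suc n) + altHarmonic₂ (suc n))) + m * m * m * m * y)
         (ι-* (suc n) (n !)) (Λ-b n) ⟩
  (m + m + 1ℚ) * (0ℚ + 0ℚ + m * p * (m * p) * (altHarmonic₂ (suc n) + altHarmonic₂ (suc n))) + m * m * m * m * (p * p * (A + A))
    ≡⟨ cong (λ x → (m + m + 1ℚ) * (0ℚ + 0ℚ + m * p * (m * p) * (x + x)) + m * m * m * m * (p * p * (A + A))) (altHarmonic₂-suc n) ⟩
  (m + m + 1ℚ) * (0ℚ + 0ℚ + m * p * (m * p) * (A + s * r + (A + s * r))) + m * m * m * m * (p * p * (A + A))
    -- The factor 2 m + 1 is split as (m + 1)² - m² to isolate one copy of m² r.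
    ≡⟨ solve 5 (λ m p A s r → let q = p :* p :* s :+ p :* p :* s in
         (m :+ m :+ con 1ℚ) :* (con 0ℚ :+ con 0ℚ :+ m :* p :* (m :* p) :* (A :+ s :* r :+ (A :+ s :* r))) :+ m :* m :* m :* m :* (p :* p :* (A :+ A))
         := (m :+ con 1ℚ) :* (m :+ con 1ℚ) :* (m :* m) :* (p :* p :* (A :+ A)) :+ q :* ((m :+ con 1ℚ) :* (m :+ con 1ℚ)) :* (m :* m :* r)
            :- q :* (m :* m) :* (m :* m :* r))
         refl m p A s r ⟩
  (m + 1ℚ) * (m + 1ℚ) * (m * m) * (p * p * (A + A)) + q * ((m + 1ℚ) * (m + 1ℚ)) * (m * m * r) - q * (m * m) * (m * m * r)
    -- Both m² r and (m + 1)² r′ are 1; exchanging them in this one place makes the rest a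
    -- polynomial identity.
    ≡⟨ cong (λ x → (m + 1ℚ) * (m + 1ℚ) * (m * m) * (p * p * (A + A)) + q * ((m + 1ℚ) * (m + 1ℚ)) * (m * m * r) - q * (m * m) * x)
         (trans (*1/[]² n) (sym (trans (cong (λ x → x * x * r′) (sym (ι-suc (suc n)))) (*1/[]² (suc n))))) ⟩
  (m + 1ℚ) * (m + 1ℚ) * (m * m) * (p * p * (A + A)) + q * ((m + 1ℚ) * (m + 1ℚ)) * (m * m * r) - q * (m * m) * ((m + 1ℚ) * (m + 1ℚ) * r′)
    ≡⟨ solve 6 (λ m p A s r r′ → let q = p :* p :* s :+ p :* p :* s ; A₂ = A :+ s :* r :+ con (- 1ℚ) :* s :* r′ in
         (m :+ con 1ℚ) :* (m :+ con 1ℚ) :* (m :* m) :* (p :* p :* (A :+ A)) :+ q :* ((m :+ con 1ℚ) :* (m :+ con 1ℚ)) :* (m :* m :* r)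
            :- q :* (m :* m) :* ((m :+ con 1ℚ) :* (m :+ con 1ℚ) :* r′)
         := (m :+ con 1ℚ) :* (m :* p) :* ((m :+ con 1ℚ) :* (m :* p)) :* (A₂ :+ A₂)) refl m p A s r r′ ⟩
  (m + 1ℚ) * (m * p) * ((m + 1ℚ) * (m * p)) * (A + s * r + - 1ℚ * s * r′ + (A + s * r + - 1ℚ * s * r′))
    ≡⟨ cong₂ (λ x y → x * x * (y + y))
         (trans (ι-* (suc (suc n)) (suc n !)) (cong₂ _*_ (ι-suc (suc n)) (ι-* (suc n) (n !))))
         (trans (altHarmonic₂-suc (suc n)) (cong (λ x → x + - 1ℚ * s * r′) (altHarmonic₂-suc n))) ⟨
  ι (suc (suc n) !) * ι (suc (suc n) !) * (altHarmonic₂ (suc (suc n)) + altHarmonic₂ (suc (suc n))) ∎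
  where
  open ≡-Reasoning
  m = ι (suc n)
  p = ι (n !)
  A = altHarmonic₂ n
  s = ε n
  r = 1/[ n ]²
  r′ = 1/[ suc n ]²
  q = p * p * s + p * p * s

-- Comparison of the two Hankel determinants

hankel-bernoulli : ∀ n → touchard n n * hankel bernoulli n ≡
  μ n n * det {n} (λ i j → bernoulli (toℕ i ℕ.+ toℕ j))
hankel-bernoulli n = hankel-lastRow-last bernoulli (touchard n) n λ k → μ≡0 k n

hankel-b : ∀ n → touchard n n * hankel b n ≡
  ε n * (Λ n b * det {n} (λ i j → bernoulli (toℕ i ℕ.+ toℕ j)))
hankel-b n = trans
  (hankel-lastRow-first b (touchard n) n λ k k<n →
    trans (Λ-cong n λ j → cong b (ℕ.+-suc j k)) (μ≡0 k n k<n))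
  (cong (ε n *_) (cong₂ _*_
    (Λ-cong n λ j → cong b (ℕ.+-identityʳ j))
    (det-cong {n} λ i j → cong b (ℕ.+-suc (toℕ i) (toℕ j)))))

-- The quotient of the two expansions in cross-multiplied form, which eliminates the common minor
-- `d` without inverting it.
hankel-b-μ : ∀ n → hankel b n * μ n n ≡ ε n * (Λ n b * hankel bernoulli n)
hankel-b-μ n = touchard-leading-cancel n (begin
  l * (hankel b n * h)                ≡⟨ *-assoc l (hankel b n) h ⟨
  l * hankel b n * h                  ≡⟨ cong (_* h) (hankel-b n) ⟩
  ε n * (Λ n b * d) * h               ≡⟨ solve 4 (λ s q d h → s :* (q :* d) :* h := s :* (q :* (h :* d))) refl (ε n) (Λ n b) d h ⟩
  ε n * (Λ n b * (h * d))             ≡⟨ cong (λ x → ε n * (Λ n b * x)) (hankel-bernoulli n) ⟨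
  ε n * (Λ n b * (l * hankel bernoulli n))
    ≡⟨ solve 4 (λ s q l H → s :* (q :* (l :* H)) := l :* (s :* (q :* H))) refl (ε n) (Λ n b) l (hankel bernoulli n) ⟩
  l * (ε n * (Λ n b * hankel bernoulli n)) ∎)
  where
  open ≡-Reasoning
  l = touchard n n
  h = μ n n
  d = det {n} (λ i j → bernoulli (toℕ i ℕ.+ toℕ j))

proposition3p1 : (n : ℕ) → n ≥ 1 →
    hankel b n ≡ (+ (2 ℕ.* (2 ℕ.* n ℕ.+ 1) !) / ((n !) ℕ.^ 3)) {{m^n≢0 (n !) 3 {{n !≢0}}}} * altHarmonic₂ n * hankel bernoulli n
proposition3p1 n _ = cancel-n! (cancel-n! (cancel-n! (cancel-n! (cancel-n! (begin
  -- Five factors n! are supplied for `μ-diagonal`; on the other side two come from `Λ-b` and three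
  -- from the denominator n!³.
  p * (p * (p * (p * (p * Hb))))
    ≡⟨ solve 2 (λ p H → p :* (p :* (p :* (p :* (p :* H)))) := p :* p :* p :* p :* p :* H) refl p Hb ⟩
  p * p * p * p * p * Hb                     ≡⟨ cong (_* Hb) (μ-diagonal n) ⟨
  s * (h * F) * Hb                           ≡⟨ solve 4 (λ s h F H → s :* (h :* F) :* H := s :* (F :* (H :* h))) refl s h F Hb ⟩
  s * (F * (Hb * h))                         ≡⟨ cong (λ x → s * (F * x)) (hankel-b-μ n) ⟩
  s * (F * (s * (Λ n b * HB)))               ≡⟨ solve 4 (λ s F q H → s :* (F :* (s :* (q :* H))) := s :* s :* (q :* F :* H)) refl s F (Λ n b) HB ⟩
  -- One sign comes from the diagonal value `μ n n`, the other from the first-column position of the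
  -- surviving entry.
  s * s * (Λ n b * F * HB)                   ≡⟨ cong₂ (λ x y → x * (y * F * HB)) (ε*ε≡1 n) (Λ-b n) ⟩
  1ℚ * (p * p * (A + A) * F * HB)
    ≡⟨ solve 4 (λ p A F H → con 1ℚ :* (p :* p :* (A :+ A) :* F :* H) := p :* p :* (con (1ℚ + 1ℚ) :* F) :* A :* H) refl p A F HB ⟩
  p * p * (ι 2 * F) * A * HB                 ≡⟨ cong (λ x → p * p * x * A * HB) (trans (sym (ι-* 2 ((2 ℕ.* n ℕ.+ 1) !))) (sym (ι-*-/ N ((n !) ℕ.^ 3)))) ⟩
  p * p * (ι ((n !) ℕ.^ 3) * c) * A * HB       ≡⟨ cong (λ x → p * p * (x * c) * A * HB) ι[n!³] ⟩
  p * p * (p * p * p * c) * A * HB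
    ≡⟨ solve 4 (λ p c A H → p :* p :* (p :* p :* p :* c) :* A :* H := p :* (p :* (p :* (p :* (p :* (c :* A :* H)))))) refl p c A HB ⟩
  p * (p * (p * (p * (p * (c * A * HB)))))   ∎)))))
  where
  open ≡-Reasoning
  instance
    n!³≢0 : NonZero ((n !) ℕ.^ 3)
    n!³≢0 = m^n≢0 (n !) 3 {{n !≢0}}
  N = 2 ℕ.* (2 ℕ.* n ℕ.+ 1) !
  F = ι ((2 ℕ.* n ℕ.+ 1) !)
  p = ι (n !)
  s = ε n
  h = μ n n
  A = altHarmonic₂ n
  Hb = hankel b n
  HB = hankel bernoulli n
  c = + N / ((n !) ℕ.^ 3)
  cancel-n! : ∀ {x y} → p * x ≡ p * y → x ≡ y
  cancel-n! = ι-cancel (n !) {{n !≢0}}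
  ι[n!³] : ι ((n !) ℕ.^ 3) ≡ p * p * p
  ι[n!³] = begin
    ι (n ! ℕ.* (n ! ℕ.* (n ! ℕ.* 1)))   ≡⟨ cong (λ k → ι (n ! ℕ.* (n ! ℕ.* k))) (ℕ.*-identityʳ (n !)) ⟩
    ι (n ! ℕ.* (n ! ℕ.* n !))           ≡⟨ trans (ι-* (n !) (n ! ℕ.* n !)) (cong (p *_) (ι-* (n !) (n !))) ⟩
    p * (p * p)                         ≡⟨ *-assoc p p p ⟨
    p * p * p                           ∎
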